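{- (i) Let $I$ be a set and $R\colon I\times I\to[0,1]$ a fuzzy equivalence. Then $([0,1]^I,g_R)$ is a monadic Pavelka algebra, where $[0,1]^I$ is the power of the standard Pavelka algebra. (ii) Let $(\mathbf A,\exists)$ be a monadic Pavelka algebra with $\mathbf A$ semisimple. Then there exist a set $I$, a fuzzy equivalence $R$ on $I$, and an injective homomorphism of Pavelka algebras $e\colon A\to[0,1]^I$ such that $e(\exists(x))=g_R(e(x))$ for all $x\in A$.
   Context: An MV-algebra $(A;\oplus,\neg,0)$ carries derived operations $1=\neg0$, $x\cdot y=\neg(\neg x\oplus\neg y)$, $x\rightarrow y=\neg x\oplus y$, lattice order $x\le y$ iff $\neg x\oplus y=1$. The standard MV-algebra is $[0,1]$ with $x\oplus y=\min\{x+y,1\}$, $\neg x=1-x$. A Pavelka algebra is $\mathbf A=(A;\oplus,\neg,\{\mathbf r\mid r\in[0,1]\cap\mathbb Q\})$ with $(A;\oplus,\neg,\mathbf 0)$ an MV-algebra, $\mathbf r\oplus\mathbf s=\mathbf t$ whenever $\min\{r+s,1\}=t$, $\neg\mathbf r=\mathbf s$ whenever $1-r=s$. The standard Pavelka algebra is $[0,1]$ with $\mathbf r$ interpreted as $r$; $[0,1]^I$ is its power. $\mathbf A$ is semisimple if its MV-reduct is a subdirect product of simple MV-algebras. A monadic Pavelka algebra is $(\mathbf A,\exists)$ with $\exists$ a closure operator (monotone, $x\le\exists x$, $\exists\exists x=\exists x$) such that $\exists(\neg\exists(x))=\neg\exists(x)$ and $\mathbf r\cdot\exists(x)=\exists(\mathbf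 r\cdot x)$ for all $x$ and constants $\mathbf r$. A fuzzy equivalence on $I$ is $R\colon I\times I\to[0,1]$ with $R(i,i)=1$, $R(i,j)=R(j,i)$, $R(i,j)\cdot R(j,k)\le R(i,k)$. For such $R$, $g_R\colon[0,1]^I\to[0,1]^I$, $g_R(x)(i)=\bigvee_{j\in I}(R(i,j)\cdot x(j))$. -}

module Defs where

open import Level using (Level; _⊔_; suc; Lift; lift; lower)
open import Data.Empty using (⊥-elim)
open import Data.Product using (∃-syntax; _×_; _,_; proj₁; proj₂)
open import Data.Sum using (_⊎_; inj₁; inj₂)
open import Data.Rational using (ℚ; 0ℚ; 1ℚ)
import Data.Rational as ℚ
import Data.Rational.Properties as ℚₚ
open import Data.Rational.Solver using (module +-*-Solver)
open import Algebra.Core using (Op₁; Op₂)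
import Algebra.Definitions as AlgDefs
open import Algebra.Structures using (IsCommutativeMonoid)
open import Function.Definitions using (Surjective)
open import Relation.Binary.Core using (Rel; _⇒_)
open import Relation.Binary.Definitions using (tri<; tri≈; tri>)
open import Relation.Binary.Structures using (IsEquivalence)
open import Relation.Binary.PropositionalEquality
  using (_≡_; refl; sym; subst)
open import Relation.Nullary using (¬_)
open import Relation.Unary using (Pred)

private
  variable
    a b c i j ℓ ℓ₁ ℓ₂ s t : Level

private
  open import Algebra.Properties.Group ℚₚ.+-0-group
    using () renaming (⁻¹-involutive to neg-involutive)

  p-1<p : ∀ p → p ℚ.- 1ℚ ℚ.< p
  p-1<p p = ℚₚ.<-respʳ-≡ (ℚₚ.+-identityʳ p)
    (ℚₚ.+-monoʳ-< p (ℚₚ.negative⁻¹ (ℚ.- 1ℚ)))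

  p<q⇒p-q<0 : ∀ {p q} → p ℚ.< q → p ℚ.- q ℚ.< 0ℚ
  p<q⇒p-q<0 {p} {q} p<q =
    ℚₚ.<-respʳ-≡ (ℚₚ.+-inverseʳ q) (ℚₚ.+-monoˡ-< (ℚ.- q) p<q)

-- A real x is represented by the lower part { q ∈ ℚ ∣ q < x } of its
-- Dedekind cut; classically the upper part is the interior of the
-- complement.  The level ℓ is that of the predicates used as cuts: it
-- makes ℝ ℓ closed under suprema of bounded nonempty families indexed by Set ℓ.
record ℝ ℓ : Set (suc ℓ) where
  field
    _∋_       : Pred ℚ ℓ
    inhabited : ∃[ q ] _∋_ q
    bounded   : ∃[ q ] ¬ _∋_ q
    downward  : ∀ {p q} → p ℚ.< q → _∋_ q → _∋_ p
    open∋     : ∀ {q} → _∋_ q → ∃[ r ] (q ℚ.< r × _∋_ r)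

  below-bound : ∀ {p q} → _∋_ p → ¬ _∋_ q → p ℚ.< q
  below-bound {p} {q} x∋p x∌q with ℚₚ.<-cmp p q
  ... | tri< p<q _ _  = p<q
  ... | tri≈ _ refl _ = ⊥-elim (x∌q x∋p)
  ... | tri> _ _ q<p  = ⊥-elim (x∌q (downward q<p x∋p))

open ℝ public using (_∋_)

infix 4 _≤ℝ_ _≈ℝ_

_≤ℝ_ : Rel (ℝ ℓ) ℓ
x ≤ℝ y = ∀ {q} → x ∋ q → y ∋ q

_≈ℝ_ : Rel (ℝ ℓ) ℓ
x ≈ℝ y = x ≤ℝ y × y ≤ℝ x

ι : ℚ → ℝ ℓ
ι {ℓ} r = record
  { _∋_       = λ q → Lift ℓ (q ℚ.< r)
  ; inhabited = r ℚ.- 1ℚ , lift (p-1<p r)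
  ; bounded   = r , λ r<r → ℚₚ.<-irrefl refl (lower r<r)
  ; downward  = λ p<q q<r → lift (ℚₚ.<-trans p<q (lower q<r))
  ; open∋     = λ q<r → let m , q<m , m<r = ℚₚ.<-dense (lower q<r)
                        in m , q<m , lift m<r
  }

infixl 6 _+ℝ_
_+ℝ_ : Op₂ (ℝ ℓ)
x +ℝ y = record
  { _∋_       = λ q → ∃[ r ] ∃[ s ] (x ∋ r × y ∋ s × q ℚ.≤ r ℚ.+ s)
  ; inhabited = let r , x∋r = X.inhabited ; s , y∋s = Y.inhabited
                in r ℚ.+ s , r , s , x∋r , y∋s , ℚₚ.≤-refl
  ; bounded   = let r′ , x∌r′ = X.bounded ; s′ , y∌s′ = Y.bounded
                in r′ ℚ.+ s′ , λ (r , s , x∋r , y∋s , r′+s′≤r+s) →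
                   ℚₚ.<-irrefl refl (ℚₚ.≤-<-trans r′+s′≤r+s
                     (ℚₚ.+-mono-< (X.below-bound x∋r x∌r′)
                                  (Y.below-bound y∋s y∌s′)))
  ; downward  = λ p<q (r , s , x∋r , y∋s , q≤r+s) →
                  r , s , x∋r , y∋s , ℚₚ.≤-trans (ℚₚ.<⇒≤ p<q) q≤r+s
  ; open∋     = λ (r , s , x∋r , y∋s , q≤r+s) →
                  let r′ , r<r′ , x∋r′ = X.open∋ x∋r
                  in r′ ℚ.+ s , ℚₚ.≤-<-trans q≤r+s (ℚₚ.+-monoˡ-< s r<r′)
                   , r′ , s , x∋r′ , y∋s , ℚₚ.≤-refl
  }
  where module X = ℝ x
        module Y = ℝ y

-- q < - x iff - q lies strictly above some non-element of the lower cut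
-- of x; the strictness keeps the cut open.
infix 8 -ℝ_
-ℝ_ : Op₁ (ℝ ℓ)
-ℝ x = record
  { _∋_       = λ q → ∃[ r ] (q ℚ.< r × ¬ (x ∋ (ℚ.- r)))
  ; inhabited = let b , x∌b = X.bounded
                in (ℚ.- b) ℚ.- 1ℚ , ℚ.- b , p-1<p (ℚ.- b)
                 , subst (λ p → ¬ (x ∋ p)) (sym (neg-involutive b)) x∌b
  ; bounded   = let l , x∋l = X.inhabited
                in ℚ.- l , λ (r , -l<r , x∌-r) → x∌-r
                   (X.downward (subst (ℚ.- r ℚ.<_) (neg-involutive l)
                                      (ℚₚ.neg-antimono-< -l<r)) x∋l)
  ; downward  = λ p<q (r , q<r , x∌-r) → r , ℚₚ.<-trans p<q q<r , x∌-r
  ; open∋     = λ (r , q<r , x∌-r) → let m , q<m , m<r = ℚₚ.<-dense q<r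
                                     in m , q<m , r , m<r , x∌-r
  }
  where module X = ℝ x

infixl 6 _-ℝ_
_-ℝ_ : Op₂ (ℝ ℓ)
x -ℝ y = x +ℝ (-ℝ y)

minℝ : Op₂ (ℝ ℓ)
minℝ x y = record
  { _∋_       = λ q → x ∋ q × y ∋ q
  ; inhabited = inh
  ; bounded   = let b , x∌b = X.bounded in b , λ (x∋b , _) → x∌b x∋b
  ; downward  = λ p<q (x∋q , y∋q) → X.downward p<q x∋q , Y.downward p<q y∋q
  ; open∋     = op
  }
  where
  module X = ℝ x
  module Y = ℝ y

  meet : ∀ {p q} → x ∋ p → y ∋ q →
         ∃[ m ] ((m ≡ p ⊎ m ≡ q) × x ∋ m × y ∋ m)
  meet {p} {q} x∋p y∋q with ℚₚ.<-cmp p q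
  ... | tri< p<q _ _  = p , inj₁ refl , x∋p , Y.downward p<q y∋q
  ... | tri≈ _ refl _ = p , inj₁ refl , x∋p , y∋q
  ... | tri> _ _ q<p  = q , inj₂ refl , X.downward q<p x∋p , y∋q

  inh : ∃[ q ] (x ∋ q × y ∋ q)
  inh with meet (proj₂ X.inhabited) (proj₂ Y.inhabited)
  ... | m , _ , both = m , both

  op : ∀ {q} → x ∋ q × y ∋ q → ∃[ r ] (q ℚ.< r × (x ∋ r × y ∋ r))
  op (x∋q , y∋q) with X.open∋ x∋q | Y.open∋ y∋q
  ... | r , q<r , x∋r | s , q<s , y∋s with meet x∋r y∋s
  ...   | _ , inj₁ refl , both = r , q<r , both
  ...   | _ , inj₂ refl , both = s , q<s , both

0ℝ 1ℝ : ℝ ℓ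
0ℝ = ι 0ℚ
1ℝ = ι 1ℚ

record [0,1] ℓ : Set (suc ℓ) where
  constructor mk
  field
    val : ℝ ℓ
    0≤  : 0ℝ ≤ℝ val
    ≤1  : val ≤ℝ 1ℝ

open [0,1] public using (val)

infix 4 _≤ᴵ_ _≈ᴵ_

_≤ᴵ_ _≈ᴵ_ : Rel ([0,1] ℓ) ℓ
x ≤ᴵ y = val x ≤ℝ val y
x ≈ᴵ y = val x ≈ℝ val y

infixl 6 _⊕ᴵ_
_⊕ᴵ_ : Op₂ ([0,1] ℓ)
x ⊕ᴵ y = mk (minℝ (val x +ℝ val y) 1ℝ)
  (λ (lift q<0) →
    let m , q<m , m<0 = ℚₚ.<-dense q<0
    in (m , _ , [0,1].0≤ x (lift m<0) , [0,1].0≤ y (lift (p<q⇒p-q<0 q<m))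
        , ℚₚ.≤-reflexive (+-*-Solver.solve 2 (λ q m → q := m :+ (q :- m)) refl _ m))
     , lift (ℚₚ.<-trans q<0 (ℚₚ.positive⁻¹ 1ℚ)))
  proj₂
  where open +-*-Solver

infix 8 ∼ᴵ_
∼ᴵ_ : Op₁ ([0,1] ℓ)
∼ᴵ_ x = mk (1ℝ -ℝ val x)
  (λ {q} (lift q<0) →
    let m , q<m , m<0 = ℚₚ.<-dense q<0
    in m ℚ.+ 1ℚ , (q ℚ.- m) ℚ.- 1ℚ
     , lift (ℚₚ.<-respʳ-≡ (ℚₚ.+-identityˡ 1ℚ) (ℚₚ.+-monoˡ-< 1ℚ m<0))
     , (ℚ.- 1ℚ , ℚₚ.<-respʳ-≡ (ℚₚ.+-identityˡ (ℚ.- 1ℚ))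
                   (ℚₚ.+-monoˡ-< (ℚ.- 1ℚ) (p<q⇒p-q<0 q<m))
        , λ x∋1 → ℚₚ.<-irrefl refl (lower ([0,1].≤1 x x∋1)))
     , ℚₚ.≤-reflexive (+-*-Solver.solve 3
         (λ q m o → q := (m :+ o) :+ ((q :- m) :- o)) refl q m 1ℚ))
  (λ (r , s , lift r<1 , (t , s<t , x∌-t) , q≤r+s) →
    lift (ℚₚ.≤-<-trans q≤r+s
      (ℚₚ.<-respʳ-≡ (ℚₚ.+-identityʳ 1ℚ)
        (ℚₚ.+-mono-< r<1 (ℚₚ.<-≤-trans s<t (ℚₚ.≮⇒≥ (λ 0<t →
          x∌-t ([0,1].0≤ x (lift (ℚₚ.neg-antimono-< {0ℚ} {t} 0<t))))))))))
  where open +-*-Solver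

-- The union of the lower cuts is the supremum in ℝ; adding the negative
-- rationals makes the supremum of the empty family 0.
⋁ : {I : Set ℓ} → (I → [0,1] ℓ) → [0,1] ℓ
⋁ {ℓ} x = mk sup (λ (lift q<0) → inj₁ (lift q<0)) below
  where
  below : ∀ {q} → Lift ℓ (q ℚ.< 0ℚ) ⊎ (∃[ i ] val (x i) ∋ q) → 1ℝ {ℓ} ∋ q
  below (inj₁ (lift q<0)) = lift (ℚₚ.<-trans q<0 (ℚₚ.positive⁻¹ 1ℚ))
  below (inj₂ (i , xi∋q)) = [0,1].≤1 (x i) xi∋q

  sup : ℝ ℓ
  sup = record
    { _∋_       = λ q → Lift ℓ (q ℚ.< 0ℚ) ⊎ (∃[ i ] val (x i) ∋ q)
    ; inhabited = ℚ.- 1ℚ , inj₁ (lift (ℚₚ.negative⁻¹ (ℚ.- 1ℚ)))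
    ; bounded   = 1ℚ , λ h → ℚₚ.<-irrefl refl (lower (below h))
    ; downward  = λ where
        p<q (inj₁ (lift q<0)) → inj₁ (lift (ℚₚ.<-trans p<q q<0))
        p<q (inj₂ (i , xi∋q)) → inj₂ (i , ℝ.downward (val (x i)) p<q xi∋q)
    ; open∋     = λ where
        (inj₁ (lift q<0)) → let m , q<m , m<0 = ℚₚ.<-dense q<0
                            in m , q<m , inj₁ (lift m<0)
        (inj₂ (i , xi∋q)) → let r , q<r , xi∋r = ℝ.open∋ (val (x i)) xi∋q
                            in r , q<r , inj₂ (i , xi∋r)
    }

record [0,1]ℚ : Set where
  constructor mkℚᴵ
  field
    valℚ : ℚ
    0≤   : 0ℚ ℚ.≤ valℚ
    ≤1   : valℚ ℚ.≤ 1ℚ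

open [0,1]ℚ public using (valℚ)

0ℚᴵ : [0,1]ℚ
0ℚᴵ = mkℚᴵ 0ℚ ℚₚ.≤-refl (ℚₚ.nonNegative⁻¹ 1ℚ)

ιᴵ : [0,1]ℚ → [0,1] ℓ
ιᴵ (mkℚᴵ r 0≤r r≤1) = mk (ι r)
  (λ (lift q<0) → lift (ℚₚ.<-≤-trans q<0 0≤r))
  (λ (lift q<r) → lift (ℚₚ.<-≤-trans q<r r≤1))

-- ∼ is the negation of the algebra, ⇀ its implication.
record RawMVAlgebra c ℓ : Set (suc (c ⊔ ℓ)) where
  infix  4 _≈_ _≤_
  infixr 5 _⇀_
  infixl 6 _⊕_
  infixl 7 _·_
  infix  8 ∼_
  field
    Carrier : Set c
    _≈_     : Rel Carrier ℓ
    _⊕_     : Op₂ Carrier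
    ∼_      : Op₁ Carrier
    0#      : Carrier

  1# : Carrier
  1# = ∼ 0#

  _·_ _⇀_ : Op₂ Carrier
  x · y = ∼ (∼ x ⊕ ∼ y)
  x ⇀ y = ∼ x ⊕ y

  _≤_ : Rel Carrier ℓ
  x ≤ y = ∼ x ⊕ y ≈ 1#

record IsMVAlgebra (M : RawMVAlgebra c ℓ) : Set (c ⊔ ℓ) where
  open RawMVAlgebra M
  open AlgDefs _≈_
  field
    ⊕-isCommutativeMonoid : IsCommutativeMonoid _≈_ _⊕_ 0#
    ∼-cong                : Congruent₁ ∼_
    ∼-involutive          : Involutive ∼_
    ⊕-zeroʳ               : RightZero 1# _⊕_
    łukasiewicz           : ∀ x y → ∼ (∼ x ⊕ y) ⊕ y ≈ ∼ (∼ y ⊕ x) ⊕ x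

record MVAlgebra c ℓ : Set (suc (c ⊔ ℓ)) where
  field
    raw         : RawMVAlgebra c ℓ
    isMVAlgebra : IsMVAlgebra raw
  open RawMVAlgebra raw public
  open IsMVAlgebra isMVAlgebra public

record IsMVHomomorphism (M : RawMVAlgebra a ℓ₁) (N : RawMVAlgebra b ℓ₂)
         (f : RawMVAlgebra.Carrier M → RawMVAlgebra.Carrier N) :
         Set (a ⊔ ℓ₁ ⊔ ℓ₂) where
  private
    module M = RawMVAlgebra M
    module N = RawMVAlgebra N
  field
    cong-≈ : ∀ {x y} → x M.≈ y → f x N.≈ f y
    ⊕-homo : ∀ x y → f (x M.⊕ y) N.≈ f x N.⊕ f y
    ∼-homo : ∀ x → f (M.∼ x) N.≈ N.∼ f x
    0-homo : f M.0# N.≈ N.0#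

record IsMVCongruence (M : RawMVAlgebra c ℓ)
         (_θ_ : Rel (RawMVAlgebra.Carrier M) ℓ) : Set (c ⊔ ℓ) where
  open RawMVAlgebra M
  open AlgDefs _θ_
  field
    isEquivalence : IsEquivalence _θ_
    reflexive     : _≈_ ⇒ _θ_
    ⊕-cong        : Congruent₂ _⊕_
    ∼-cong        : Congruent₁ ∼_

-- Exactly two congruences.
record IsSimple (M : RawMVAlgebra c ℓ) : Set (c ⊔ suc ℓ) where
  open RawMVAlgebra M
  field
    nontrivial  : ¬ (0# ≈ 1#)
    congruences : (_θ_ : Rel Carrier ℓ) → IsMVCongruence M _θ_ →
                  (_θ_ ⇒ _≈_) ⊎ (∀ x y → x θ y)

-- A representation of M as a subdirect product of simple MV-algebras.
record Semisimple j s t (M : RawMVAlgebra a ℓ) :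
         Set (a ⊔ ℓ ⊔ suc (j ⊔ s ⊔ t)) where
  private module M = RawMVAlgebra M
  field
    J          : Set j
    factor     : J → MVAlgebra s t
    simple     : ∀ k → IsSimple (MVAlgebra.raw (factor k))
    π          : ∀ k → M.Carrier → MVAlgebra.Carrier (factor k)
    π-homo     : ∀ k → IsMVHomomorphism M (MVAlgebra.raw (factor k)) (π k)
    surjective : ∀ k → Surjective M._≈_ (MVAlgebra._≈_ (factor k)) (π k)
    separating : ∀ {x y} → (∀ k → MVAlgebra._≈_ (factor k) (π k x) (π k y)) →
                 x M.≈ y

record RawPavelkaAlgebra c ℓ : Set (suc (c ⊔ ℓ)) where
  infix  4 _≈_
  infixl 6 _⊕_
  infix  8 ∼_
  field
    Carrier : Set c
    _≈_     : Rel Carrier ℓ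
    _⊕_     : Op₂ Carrier
    ∼_      : Op₁ Carrier
    const   : [0,1]ℚ → Carrier

  rawMV : RawMVAlgebra c ℓ
  rawMV = record
    { Carrier = Carrier ; _≈_ = _≈_ ; _⊕_ = _⊕_ ; ∼_ = ∼_ ; 0# = const 0ℚᴵ }

  open RawMVAlgebra rawMV public using (0#; 1#; _·_; _⇀_; _≤_)

record IsPavelkaAlgebra (P : RawPavelkaAlgebra c ℓ) : Set (c ⊔ ℓ) where
  open RawPavelkaAlgebra P
  field
    isMVAlgebra : IsMVAlgebra rawMV
    const-⊕     : ∀ r s t → (valℚ r ℚ.+ valℚ s) ℚ.⊓ 1ℚ ≡ valℚ t →
                  const r ⊕ const s ≈ const t
    const-∼     : ∀ r s → 1ℚ ℚ.- valℚ r ≡ valℚ s → ∼ const r ≈ const s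

record IsPavelkaHomomorphism
         (P : RawPavelkaAlgebra a ℓ₁) (Q : RawPavelkaAlgebra b ℓ₂)
         (f : RawPavelkaAlgebra.Carrier P → RawPavelkaAlgebra.Carrier Q) :
         Set (a ⊔ ℓ₁ ⊔ ℓ₂) where
  private
    module P = RawPavelkaAlgebra P
    module Q = RawPavelkaAlgebra Q
  field
    cong-≈     : ∀ {x y} → x P.≈ y → f x Q.≈ f y
    ⊕-homo     : ∀ x y → f (x P.⊕ y) Q.≈ f x Q.⊕ f y
    ∼-homo     : ∀ x → f (P.∼ x) Q.≈ Q.∼ f x
    const-homo : ∀ r → f (P.const r) Q.≈ Q.const r

standard : ∀ ℓ → RawPavelkaAlgebra (suc ℓ) ℓ
standard ℓ = record
  { Carrier = [0,1] ℓ ; _≈_ = _≈ᴵ_ ; _⊕_ = _⊕ᴵ_ ; ∼_ = ∼ᴵ_ ; const = ιᴵ }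

_^ᴾ_ : RawPavelkaAlgebra c ℓ → (I : Set i) → RawPavelkaAlgebra (c ⊔ i) (ℓ ⊔ i)
P ^ᴾ I = record
  { Carrier = I → Carrier
  ; _≈_     = λ x y → ∀ k → x k ≈ y k
  ; _⊕_     = λ x y k → x k ⊕ y k
  ; ∼_      = λ x k → ∼ x k
  ; const   = λ r _ → const r
  }
  where open RawPavelkaAlgebra P

[0,1]^_ : (I : Set ℓ) → RawPavelkaAlgebra (suc ℓ) ℓ
[0,1]^_ {ℓ} I = standard ℓ ^ᴾ I

-- E is the quantifier ∃.  It respects ≈ because it is monotone and the
-- order of an MV-algebra is antisymmetric.
record IsMonadicPavelkaAlgebra (P : RawPavelkaAlgebra c ℓ)
         (E : Op₁ (RawPavelkaAlgebra.Carrier P)) : Set (c ⊔ ℓ) where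
  open RawPavelkaAlgebra P
  field
    isPavelkaAlgebra : IsPavelkaAlgebra P
    E-mono           : ∀ {x y} → x ≤ y → E x ≤ E y
    E-extensive      : ∀ x → x ≤ E x
    E-idempotent     : ∀ x → E (E x) ≈ E x
    E-∼              : ∀ x → E (∼ E x) ≈ ∼ E x
    E-const          : ∀ r x → const r · E x ≈ E (const r · x)

record MonadicPavelkaAlgebra c ℓ : Set (suc (c ⊔ ℓ)) where
  field
    pavelka                 : RawPavelkaAlgebra c ℓ
    E                       : Op₁ (RawPavelkaAlgebra.Carrier pavelka)
    isMonadicPavelkaAlgebra : IsMonadicPavelkaAlgebra pavelka E
  open RawPavelkaAlgebra pavelka public
  open IsMonadicPavelkaAlgebra isMonadicPavelkaAlgebra public

infixl 7 _·ᴵ_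
_·ᴵ_ : Op₂ ([0,1] ℓ)
_·ᴵ_ {ℓ} = RawPavelkaAlgebra._·_ (standard ℓ)

record IsFuzzyEquivalence {I : Set ℓ} (R : I → I → [0,1] ℓ) : Set ℓ where
  field
    reflexive  : ∀ i → val (R i i) ≈ℝ 1ℝ
    symmetric  : ∀ i j → R i j ≈ᴵ R j i
    transitive : ∀ i j k → R i j ·ᴵ R j k ≤ᴵ R i k

g : {I : Set ℓ} → (I → I → [0,1] ℓ) → (I → [0,1] ℓ) → (I → [0,1] ℓ)
g R x i = ⋁ λ j → R i j ·ᴵ x j

{-# OPTIONS --safe #-}
-- (i) In a complete MV-chain the product is residuated, hence distributes over suprema;
-- the axioms for g R then follow from reflexivity, symmetry and transitivity of R.
--
-- (ii) Let I be the set of all homomorphisms t : A → [0,1], and let R(s,t) be the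
-- infimum of t(z) over the closed z (∃z = z) with s(z) = 1.  Closed elements are stable
-- under negation and constants, which makes R symmetric and transitive and gives
-- R(s,t) · t(x) ≤ s(∃x).  For the converse let 0 < r ≤ s(∃x).  A homomorphism t
-- with r ≤ t(z · x) for all closed z with s(z) = 1 satisfies r ≤ R(s,t) · t(x).  Such a t
-- exists by compactness: the z in question are stable under meets, and if one of them had
-- z · x ≤ k < r, then ∃x ≤ z → k because z → k is closed, so that s(∃x) ≤ k.
-- By semisimplicity the homomorphisms into [0,1] separate the elements of A.
module Submission where

open import Defs
import Level
open import Level using (Level; _⊔_; Lift; lift; lower)
open import Algebra.Bundles using (AbelianGroup)
import Algebra.Properties.AbelianGroup as AbelianGroupProperties
open import Algebra.Core using (Op₁)
open import Algebra.Structures using (IsCommutativeMonoid)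
open import Axiom.ExcludedMiddle using (ExcludedMiddle)
open import Axiom.Extensionality.Propositional using (Extensionality)
open import Data.Bool using (Bool; true; false)
open import Data.Empty using (⊥-elim)
import Data.Integer as ℤ
import Data.Integer.Properties as ℤₚ
open import Data.List using (List; []; _∷_; _++_)
open import Data.List.Relation.Binary.Subset.Propositional using (_⊆_)
open import Data.List.Relation.Binary.Subset.Propositional.Properties using (All-resp-⊇)
open import Data.List.Relation.Unary.All using (All; []; _∷_)
import Data.List.Relation.Unary.All as All
import Data.List.Relation.Unary.All.Properties as Allₚ
open import Data.List.Relation.Unary.Any using (here; there)
open import Data.Nat using (ℕ; zero; suc)
import Data.Nat as ℕ
open import Data.Product using (Σ; Σ-syntax; ∃-syntax; _×_; _,_; proj₁; proj₂; swap)
open import Data.Rational using (ℚ; 0ℚ; 1ℚ; mkℚ)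
import Data.Rational as ℚ
import Data.Rational.Properties as ℚₚ
open import Data.Rational.Solver using (module +-*-Solver)
import Data.Rational.Unnormalised as ℚᵘ
import Data.Rational.Unnormalised.Properties as ℚᵘₚ
open import Data.Sum using (_⊎_; inj₁; inj₂; [_,_]′; fromInj₁; fromInj₂)
open import Function using (id; _∘_; case_of_)
open import Function.Definitions using (Injective)
open import Relation.Binary.Bundles using (Preorder)
import Relation.Binary.PropositionalEquality as ≡
open ≡ using (_≡_)
import Relation.Binary.Reasoning.Preorder as PreorderReasoning
import Relation.Binary.Reasoning.Setoid as SetoidReasoning
open import Relation.Nullary using (¬_; does; yes; no)
open import Relation.Nullary.Decidable using (decidable-stable; from-yes; from-no)
open +-*-Solver using (solve; _:=_; _:+_; _:-_; _:*_; :-_; con)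

-- MV-algebras

-- Only approximate solutions are at hand: for each `d < 1` there is a homomorphism giving `z · x`
-- at least the value `r · d`, with no control over how it varies with `d`. An exact one has to be
-- extracted, although the archimedean property of a homomorphism is not a condition on finitely
-- many elements. Hence sets are maximised for the property that every finite part is satisfied to
-- each degree below 1 by some genuine homomorphism; the maximal sets inherit the archimedean
-- property from the degrees at which elements are excluded. Constants make this expressible inside
-- the algebra: `r ≤ t(x)` says that `t` sends `const r ⇀ x` to 1, so a homomorphism is recovered
-- from the set of elements that it sends to 1.

module MVProperties {c ℓ} {M : RawMVAlgebra c ℓ} (isMV : IsMVAlgebra M) where
  open RawMVAlgebra M
  open IsMVAlgebra isMV
  open IsCommutativeMonoid ⊕-isCommutativeMonoid
    using (refl; sym; trans; isEquivalence)
    renaming (comm to ⊕-comm; assoc to ⊕-assoc; identityˡ to ⊕-identityˡ;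
              identityʳ to ⊕-identityʳ; ∙-cong to ⊕-cong) public

  ⊕-congˡ : ∀ {x y z} → y ≈ z → x ⊕ y ≈ x ⊕ z
  ⊕-congˡ = ⊕-cong refl

  ⊕-congʳ : ∀ {x y z} → y ≈ z → y ⊕ x ≈ z ⊕ x
  ⊕-congʳ p = ⊕-cong p refl

  ⇀-cong : ∀ {x x′ y y′} → x ≈ x′ → y ≈ y′ → x ⇀ y ≈ x′ ⇀ y′
  ⇀-cong p q = ⊕-cong (∼-cong p) q

  ⇀-zeroʳ : ∀ x → x ⇀ 1# ≈ 1#
  ⇀-zeroʳ x = ⊕-zeroʳ (∼ x)

  ⇀-identityˡ : ∀ x → 1# ⇀ x ≈ x
  ⇀-identityˡ x = trans (⊕-congʳ (∼-involutive 0#)) (⊕-identityˡ x)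

  ⇀-refl : ∀ x → x ⇀ x ≈ 1#
  ⇀-refl x = trans (⊕-congʳ (∼-cong (sym (⇀-identityˡ x))))
    (trans (sym (łukasiewicz x 1#)) (⊕-zeroʳ _))

  ≤-reflexive : ∀ {x y} → x ≈ y → x ≤ y
  ≤-reflexive p = trans (⊕-congˡ (sym p)) (⇀-refl _)

  ≤-refl : ∀ {x} → x ≤ x
  ≤-refl = ⇀-refl _

  ≤-antisym : ∀ {x y} → x ≤ y → y ≤ x → x ≈ y
  ≤-antisym {x} {y} x≤y y≤x =
    trans (sym (trans (⇀-cong y≤x refl) (⇀-identityˡ x)))
      (trans (sym (łukasiewicz x y)) (trans (⇀-cong x≤y refl) (⇀-identityˡ y)))

  x≤y⊕x : ∀ x y → x ≤ y ⊕ x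
  x≤y⊕x x y = trans (⊕-congˡ (⊕-comm y x)) (trans (sym (⊕-assoc _ _ _))
    (trans (⊕-congʳ (⇀-refl x)) (trans (⊕-comm _ _) (⊕-zeroʳ y))))

  x≤x⊕y : ∀ x y → x ≤ x ⊕ y
  x≤x⊕y x y = trans (⊕-congˡ (⊕-comm x y)) (x≤y⊕x x y)

  -- The Łukasiewicz axiom supplies a summand that leads from `x` up to `y`. With it, transitivity
  -- of `≤` and monotonicity of `⊕` reduce to associativity and absorption by `1#`.
  ≤⇒≈⊕ : ∀ {x y} → x ≤ y → y ≈ ((y ⇀ x) ⇀ 0#) ⊕ x
  ≤⇒≈⊕ {x} {y} x≤y = trans (sym (⇀-identityˡ y))
    (trans (⇀-cong (sym x≤y) refl)
      (trans (łukasiewicz x y) (⊕-congʳ (sym (⊕-identityʳ _)))))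

  ≤-trans : ∀ {x y z} → x ≤ y → y ≤ z → x ≤ z
  ≤-trans {x} {y} {z} x≤y y≤z =
    trans (⊕-congˡ (trans (≤⇒≈⊕ y≤z) (⊕-comm _ _)))
      (trans (sym (⊕-assoc _ _ _)) (trans (⊕-congʳ x≤y)
        (trans (⊕-comm _ _) (⊕-zeroʳ _))))

  preorder : Preorder c ℓ ℓ
  preorder = record
    { Carrier = Carrier ; _≈_ = _≈_ ; _≲_ = _≤_
    ; isPreorder = record
      { isEquivalence = isEquivalence ; reflexive = ≤-reflexive ; trans = ≤-trans } }

  module ≤-Reasoning = PreorderReasoning preorder

  ⊕-monoˡ : ∀ {x y} z → x ≤ y → x ⊕ z ≤ y ⊕ z
  ⊕-monoˡ z x≤y = ≤-trans (x≤y⊕x _ _)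
    (≤-reflexive (trans (sym (⊕-assoc _ _ _)) (⊕-congʳ (sym (≤⇒≈⊕ x≤y)))))

  ⊕-monoʳ : ∀ {x y} z → x ≤ y → z ⊕ x ≤ z ⊕ y
  ⊕-monoʳ z x≤y = ≤-trans (≤-reflexive (⊕-comm _ _))
    (≤-trans (⊕-monoˡ z x≤y) (≤-reflexive (⊕-comm _ _)))

  ⊕-mono : ∀ {x y u v} → x ≤ y → u ≤ v → x ⊕ u ≤ y ⊕ v
  ⊕-mono p q = ≤-trans (⊕-monoˡ _ p) (⊕-monoʳ _ q)

  ∼-anti : ∀ {x y} → x ≤ y → ∼ y ≤ ∼ x
  ∼-anti x≤y = trans (⊕-congʳ (∼-involutive _)) (trans (⊕-comm _ _) x≤y)

  ≤∼⇒≤∼ : ∀ {x y} → x ≤ ∼ y → y ≤ ∼ x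
  ≤∼⇒≤∼ p = trans (⊕-comm _ _) p

  ∼≤⇒∼≤ : ∀ {x y} → ∼ x ≤ y → ∼ y ≤ x
  ∼≤⇒∼≤ p = ≤-trans (∼-anti p) (≤-reflexive (∼-involutive _))

  1-max : ∀ x → x ≤ 1#
  1-max = ⇀-zeroʳ

  0-min : ∀ x → 0# ≤ x
  0-min x = trans (⊕-comm _ _) (⊕-zeroʳ x)

  ⇀-monoʳ : ∀ {x y} z → x ≤ y → z ⇀ x ≤ z ⇀ y
  ⇀-monoʳ z = ⊕-monoʳ (∼ z)

  ⇀-antiˡ : ∀ {x y} z → x ≤ y → y ⇀ z ≤ x ⇀ z
  ⇀-antiˡ z p = ⊕-monoˡ z (∼-anti p)

  ·-cong : ∀ {x x′ y y′} → x ≈ x′ → y ≈ y′ → x · y ≈ x′ · y′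
  ·-cong p q = ∼-cong (⊕-cong (∼-cong p) (∼-cong q))

  ·-comm : ∀ x y → x · y ≈ y · x
  ·-comm x y = ∼-cong (⊕-comm _ _)

  ·-assoc : ∀ x y z → (x · y) · z ≈ x · (y · z)
  ·-assoc x y z = ∼-cong (trans (⊕-congʳ (∼-involutive _))
    (trans (⊕-assoc _ _ _) (⊕-congˡ (sym (∼-involutive _)))))

  ·-identityˡ : ∀ x → 1# · x ≈ x
  ·-identityˡ x = trans (∼-cong (⇀-identityˡ _)) (∼-involutive x)

  curry-⇀ : ∀ x y z → (x · y) ⇀ z ≈ x ⇀ (y ⇀ z)
  curry-⇀ x y z = trans (⊕-congʳ (∼-involutive _)) (⊕-assoc _ _ _)

  residual : ∀ {x y z} → x · y ≤ z → x ≤ y ⇀ z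
  residual {x} {y} {z} p = trans (sym (curry-⇀ x y z)) p

  unresidual : ∀ {x y z} → x ≤ y ⇀ z → x · y ≤ z
  unresidual {x} {y} {z} p = trans (curry-⇀ x y z) p

  ·-mono : ∀ {x y u v} → x ≤ y → u ≤ v → x · u ≤ y · v
  ·-mono p q = ∼-anti (⊕-mono (∼-anti p) (∼-anti q))

  x·y≤x : ∀ x y → x · y ≤ x
  x·y≤x x y = ≤-trans (·-mono ≤-refl (1-max y))
    (≤-reflexive (trans (·-comm _ _) (·-identityˡ x)))

  x·y≤y : ∀ x y → x · y ≤ y
  x·y≤y x y = ≤-trans (≤-reflexive (·-comm x y)) (x·y≤x y x)

  modus-ponens : ∀ x y → x · (x ⇀ y) ≤ y
  modus-ponens x y = ≤-trans (≤-reflexive (·-comm _ _)) (unresidual ≤-refl)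

  y≤x⇀y : ∀ x y → y ≤ x ⇀ y
  y≤x⇀y x y = x≤y⊕x y (∼ x)

  ⇀-trans : ∀ x y z → (x ⇀ y) · (y ⇀ z) ≤ x ⇀ z
  ⇀-trans x y z = residual (≤-trans (≤-reflexive
      (trans (·-comm _ _) (sym (·-assoc _ _ _))))
    (≤-trans (·-mono (modus-ponens x y) ≤-refl) (modus-ponens y z)))

  -- Up to double negation, adding `z` is the implication `∼ z ⇀ _`, so this is transitivity of `⇀`.
  ⇀-⊕ʳ : ∀ x y z → x ⇀ y ≤ (z ⊕ x) ⇀ (z ⊕ y)
  ⇀-⊕ʳ x y z = residual (begin
    (x ⇀ y) · (z ⊕ x)      ≈⟨ ·-cong refl (⊕-congʳ (∼-involutive z)) ⟨
    (x ⇀ y) · (∼ z ⇀ x)    ≈⟨ ·-comm _ _ ⟩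
    (∼ z ⇀ x) · (x ⇀ y)    ≲⟨ ⇀-trans (∼ z) x y ⟩
    ∼ z ⇀ y                ≈⟨ ⊕-congʳ (∼-involutive z) ⟩
    z ⊕ y                  ∎)
    where open ≤-Reasoning

  ⇀-⊕ : ∀ x x′ y y′ → (x ⇀ x′) · (y ⇀ y′) ≤ x ⊕ y ⇀ x′ ⊕ y′
  ⇀-⊕ x x′ y y′ = ≤-trans (·-mono
      (≤-trans (⇀-⊕ʳ x x′ y) (≤-reflexive (⇀-cong (⊕-comm _ _) (⊕-comm _ _))))
      (⇀-⊕ʳ y y′ x′))
    (⇀-trans _ _ _)

  ⇀-contrapositive : ∀ x y → x ⇀ y ≈ ∼ y ⇀ ∼ x
  ⇀-contrapositive x y = trans (⊕-comm _ _) (⊕-congʳ (sym (∼-involutive y)))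

  exchange : ∀ {x y z} → x · z ≤ y → x · ∼ y ≤ ∼ z
  exchange p = unresidual (≤-trans (residual p) (≤-reflexive (⇀-contrapositive _ _)))

  -- This is the Łukasiewicz axiom seen through `∼`. It makes `x · (x ⇀ y)` symmetric, which is why
  -- this product is a meet.
  divisibility : ∀ x y → x · (x ⇀ y) ≈ y · (y ⇀ x)
  divisibility x y = ∼-cong (trans (⊕-comm _ _) (trans (flip x y)
      (trans (łukasiewicz _ _) (trans (sym (flip y x)) (⊕-comm _ _)))))
    where
    flip : ∀ x y → ∼ (x ⇀ y) ⊕ ∼ x ≈ ∼ (∼ ∼ y ⊕ ∼ x) ⊕ ∼ x
    flip x y = ⊕-congʳ (∼-cong (⇀-contrapositive x y))

  infixr 6 _∧_
  _∧_ : Carrier → Carrier → Carrier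
  x ∧ y = x · (x ⇀ y)

  ∧-lowerˡ : ∀ x y → x ∧ y ≤ x
  ∧-lowerˡ x y = x·y≤x _ _

  ∧-lowerʳ : ∀ x y → x ∧ y ≤ y
  ∧-lowerʳ = modus-ponens

  ·≤∧ : ∀ x y → x · y ≤ x ∧ y
  ·≤∧ x y = ·-mono ≤-refl (y≤x⇀y x y)

  ∧-greatest : ∀ {x y z} → z ≤ x → z ≤ y → z ≤ x ∧ y
  ∧-greatest {x} {y} {z} p q = begin
    z            ≈⟨ trans (sym (·-identityˡ z)) (·-comm _ _) ⟩
    z · 1#       ≈⟨ ·-cong refl p ⟨
    z ∧ x        ≈⟨ divisibility z x ⟩
    x · (x ⇀ z)  ≲⟨ ·-mono ≤-refl (⇀-monoʳ x q) ⟩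
    x ∧ y        ∎
    where open ≤-Reasoning

  infixr 6 _∨_
  _∨_ : Carrier → Carrier → Carrier
  x ∨ y = (x ⇀ y) ⇀ y

  ∨-upperʳ : ∀ x y → y ≤ x ∨ y
  ∨-upperʳ x y = y≤x⇀y _ _

  ∨-comm : ∀ x y → x ∨ y ≈ y ∨ x
  ∨-comm = łukasiewicz

  ∨-upperˡ : ∀ x y → x ≤ x ∨ y
  ∨-upperˡ x y = ≤-trans (∨-upperʳ y x) (≤-reflexive (∨-comm y x))

  ∨-least : ∀ {x y z} → x ≤ z → y ≤ z → x ∨ y ≤ z
  ∨-least {x} {y} {z} p q = begin
    x ∨ y   ≲⟨ ⇀-antiˡ y (⇀-antiˡ y p) ⟩
    z ∨ y   ≈⟨ ∨-comm z y ⟩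
    y ∨ z   ≈⟨ ⇀-cong q refl ⟩
    1# ⇀ z  ≈⟨ ⇀-identityˡ z ⟩
    z       ∎
    where open ≤-Reasoning

  ∼x·x≤0 : ∀ x → ∼ x · x ≤ 0#
  ∼x·x≤0 x = unresidual (x≤x⊕y _ _)

  -- Chang's computation that x ⊖ y and y ⊖ x are disjoint.
  ⊖-disjoint : ∀ x y → (x · ∼ y) ∧ (y · ∼ x) ≤ 0#
  ⊖-disjoint x y = begin
    x · ∼ y · (x · ∼ y ⇀ q)            ≈⟨ ·-cong refl p⇀q ⟩
    x · ∼ y · (y ⊕ w)                  ≈⟨ ·-assoc x (∼ y) (y ⊕ w) ⟩
    x · (∼ y · (y ⊕ w))                ≈⟨ ·-cong refl (·-cong refl (⊕-congʳ (sym (∼-involutive y)))) ⟩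
    x · (∼ y ∧ w)                      ≈⟨ ·-cong refl (divisibility (∼ y) w) ⟩
    x · (w ∧ ∼ y)                      ≈⟨ ·-assoc x w (w ⇀ ∼ y) ⟨
    (x ∧ q) · (w ⇀ ∼ y)                ≲⟨ ·-mono (∧-lowerʳ x q) ≤-refl ⟩
    y · ∼ x · (w ⇀ ∼ y)                ≈⟨ ·-cong (·-comm y (∼ x)) refl ⟩
    ∼ x · y · (w ⇀ ∼ y)                ≈⟨ ·-assoc (∼ x) y (w ⇀ ∼ y) ⟩
    ∼ x · (y · (w ⇀ ∼ y))              ≈⟨ ·-cong refl (·-cong refl (⊕-comm (∼ w) (∼ y))) ⟩
    ∼ x · (y ∧ ∼ w)                    ≲⟨ ·-mono ≤-refl (≤-trans (∧-lowerʳ y (∼ w)) (∼≤⇒∼≤ (x≤x⊕y (∼ x) q))) ⟩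
    ∼ x · x                            ≲⟨ ∼x·x≤0 x ⟩
    0#                                 ∎
    where
    open ≤-Reasoning
    q = y · ∼ x
    w = x ⇀ q
    p⇀q : x · ∼ y ⇀ q ≈ y ⊕ w
    p⇀q = trans (⇀-cong (·-comm x (∼ y)) refl)
      (trans (curry-⇀ (∼ y) x q) (⊕-congʳ (∼-involutive y)))

  ∼⇀ : ∀ x y → ∼ (x ⇀ y) ≈ x · ∼ y
  ∼⇀ x y = ∼-cong (⊕-congˡ (sym (∼-involutive y)))

  -- By De Morgan, the complement of the join lies below both differences `x · ∼ y` and `y · ∼ x`,
  -- whose meet is `0#`.
  prelinearity : ∀ x y → (x ⇀ y) ∨ (y ⇀ x) ≈ 1#
  prelinearity x y = ≤-antisym (1-max _) (≤-trans (∼-anti ⊖⊖) (≤-reflexive (∼-involutive _)))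
    where
    ⊖⊖ : ∼ ((x ⇀ y) ∨ (y ⇀ x)) ≤ 0#
    ⊖⊖ = ≤-trans (∧-greatest
      (≤-trans (∼-anti (∨-upperˡ _ _)) (≤-reflexive (∼⇀ x y)))
      (≤-trans (∼-anti (∨-upperʳ _ _)) (≤-reflexive (∼⇀ y x)))) (⊖-disjoint x y)

  -- Residuation allows a case split in each factor; every case except `u · a` is absorbed by `b`.
  -- It serves to keep `a ^ k ∨ b` in a filter that contains `a ∨ b`.
  ∨-·-distrib : ∀ u a b → (u ∨ b) · (a ∨ b) ≤ (u · a) ∨ b
  ∨-·-distrib u a b = unresidual (∨-least
    (residual (≤-trans (≤-reflexive (·-comm _ _)) (unresidual (∨-least
      (residual (≤-trans (≤-reflexive (·-comm a u)) (∨-upperˡ _ b)))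
      (residual (≤-trans (x·y≤x b u) (∨-upperʳ _ b)))))))
    (residual (≤-trans (x·y≤x b _) (∨-upperʳ _ b))))

  infixr 8 _^_
  _^_ : Carrier → ℕ → Carrier
  x ^ zero  = 1#
  x ^ suc n = x ^ n · x

  ^-+ : ∀ x m n → x ^ (n Data.Nat.+ m) ≈ x ^ m · x ^ n
  ^-+ x m zero    = trans (sym (·-identityˡ _)) (·-comm _ _)
  ^-+ x m (suc n) = trans (·-cong (^-+ x m n) refl) (·-assoc _ _ _)

module AffineIdentities {c ℓ} (G : AbelianGroup c ℓ) where
  open AbelianGroup G
  open AbelianGroupProperties G
  open SetoidReasoning setoid

  u-[u-x]≈x : ∀ u x → u - (u - x) ≈ x
  u-[u-x]≈x u x = begin
    u ∙ (u - x) ⁻¹  ≈⟨ ∙-congˡ (⁻¹-anti-homo‿- u x) ⟩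
    u ∙ (x - u)     ≈⟨ assoc u x (u ⁻¹) ⟨
    u ∙ x - u       ≈⟨ xyx⁻¹≈y u x ⟩
    x               ∎

  u-[[u-y]+x]+x≈y : ∀ u y x → (u - ((u - y) ∙ x)) ∙ x ≈ y
  u-[[u-y]+x]+x≈y u y x = begin
    (u - ((u - y) ∙ x)) ∙ x        ≈⟨ ∙-congʳ (∙-congˡ (⁻¹-∙-comm (u - y) x)) ⟨
    (u ∙ ((u - y) ⁻¹ ∙ x ⁻¹)) ∙ x  ≈⟨ ∙-congʳ (assoc u _ _) ⟨
    (u - (u - y) - x) ∙ x          ≈⟨ //-rightDividesˡ x _ ⟩
    u - (u - y)                    ≈⟨ u-[u-x]≈x u y ⟩
    y                              ∎

-- The unit interval

module RationalOrder where
  open import Data.Rational using (_≤_; _<_; _+_; _-_; _*_; -_; toℚᵘ)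

  module _ {c d : ℚ} (a b : ℚ) (eq : c + b ≡ d + a) where
    -- The balance `eq` says `d - c = b - a`, so a linear inequality follows from a known one by a
    -- single ring identity.
    transfer-≤ : a ≤ b → c ≤ d
    transfer-≤ a≤b = ≡.subst₂ _≤_
      (solve 2 (λ c b → c :+ b :- b := c) ≡.refl c b)
      (solve 2 (λ d b → d :+ b :- b := d) ≡.refl d b)
      (ℚₚ.+-monoˡ-≤ (- b) (≡.subst (_≤ d + b) (≡.sym eq) (ℚₚ.+-monoʳ-≤ d a≤b)))

    transfer-< : a < b → c < d
    transfer-< a<b = ≡.subst₂ _<_
      (solve 2 (λ c b → c :+ b :- b := c) ≡.refl c b)
      (solve 2 (λ d b → d :+ b :- b := d) ≡.refl d b)
      (ℚₚ.+-monoˡ-< (- b) (≡.subst (_< d + b) (≡.sym eq) (ℚₚ.+-monoʳ-< d a<b)))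

  natℚ : ℕ → ℚ
  natℚ zero    = 0ℚ
  natℚ (suc n) = 1ℚ + natℚ n

  toℚᵘ-natℚ : ∀ n → toℚᵘ (natℚ n) ℚᵘ.≃ ℚᵘ.mkℚᵘ (ℤ.+ n) 0
  toℚᵘ-natℚ zero    = ℚᵘₚ.≃-refl
  toℚᵘ-natℚ (suc n) = ℚᵘₚ.≃-trans (ℚₚ.toℚᵘ-homo-+ 1ℚ (natℚ n))
    (ℚᵘₚ.≃-trans (ℚᵘₚ.+-congʳ ℚᵘ.1ℚᵘ (toℚᵘ-natℚ n))
      (ℚᵘ.*≡* (≡.cong (λ z → (ℤ.+ 1 ℤ.+ z) ℤ.* ℤ.+ 1) (ℤₚ.*-identityʳ (ℤ.+ n)))))

  ≤-natℚ : ∀ p → ∃[ n ] p ≤ natℚ n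
  ≤-natℚ p@(mkℚ num d-1 _) = ℤ.∣ num ∣ ,
    ℚₚ.toℚᵘ-cancel-≤ (ℚᵘₚ.≤-respʳ-≃ (ℚᵘₚ.≃-sym (toℚᵘ-natℚ ℤ.∣ num ∣)) (ℚᵘ.*≤* le))
    where
    open ℤₚ.≤-Reasoning
    i≤∣i∣ : ∀ i → i ℤ.≤ ℤ.+ ℤ.∣ i ∣
    i≤∣i∣ (ℤ.+ n)      = ℤₚ.≤-refl
    i≤∣i∣ ℤ.-[1+ n ] = ℤ.-≤+
    le : num ℤ.* ℤ.+ 1 ℤ.≤ ℤ.+ ℤ.∣ num ∣ ℤ.* ℤ.+ suc d-1
    le = begin
      num ℤ.* ℤ.+ 1             ≡⟨ ℤₚ.*-identityʳ num ⟩
      num                       ≤⟨ i≤∣i∣ num ⟩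
      ℤ.+ ℤ.∣ num ∣             ≡⟨ ℤₚ.*-identityʳ _ ⟨
      ℤ.+ ℤ.∣ num ∣ ℤ.* ℤ.+ 1   ≤⟨ ℤₚ.*-monoˡ-≤-nonNeg (ℤ.+ ℤ.∣ num ∣) (ℤ.+≤+ (ℕ.s≤s ℕ.z≤n)) ⟩
      ℤ.+ ℤ.∣ num ∣ ℤ.* ℤ.+ suc d-1 ∎

  archimedean : ∀ {ε} → 0ℚ < ε → ∀ p → ∃[ n ] p ≤ natℚ n * ε
  archimedean {ε} 0<ε p = n , (begin
      p                        ≡⟨ ℚₚ.*-identityʳ p ⟨
      p * 1ℚ                   ≡⟨ ≡.cong (p *_) (ℚₚ.*-inverseˡ ε) ⟨
      p * ((ℚ.1/ ε) * ε)       ≡⟨ ℚₚ.*-assoc p (ℚ.1/ ε) ε ⟨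
      p * (ℚ.1/ ε) * ε         ≤⟨ ℚₚ.*-monoʳ-≤-nonNeg ε (proj₂ (≤-natℚ (p * ℚ.1/ ε))) ⟩
      natℚ n * ε               ∎)
    where
    open ℚₚ.≤-Reasoning
    instance
      ε-pos : ℚ.Positive ε
      ε-pos = ℚ.positive 0<ε
      ε-nonZero : ℚ.NonZero ε
      ε-nonZero = ℚₚ.pos⇒nonZero ε
      ε-nonNeg : ℚ.NonNegative ε
      ε-nonNeg = ℚₚ.pos⇒nonNeg ε
    n = proj₁ (≤-natℚ (p * ℚ.1/ ε))

open RationalOrder

module Cuts (em : ∀ {ℓ} → ExcludedMiddle ℓ) where
  open import Data.Rational using (_<_; _+_; _-_; _*_; -_)

  private variable ℓ : Level

  ≤ℝ-total : (x y : ℝ ℓ) → x ≤ℝ y ⊎ y ≤ℝ x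
  ≤ℝ-total x y with em {P = ∃[ q ] (x ∋ q × ¬ (y ∋ q))}
  ... | yes (q , x∋q , y∌q) = inj₂ λ y∋p → ℝ.downward x (ℝ.below-bound y y∋p y∌q) x∋q
  ... | no none = inj₁ λ {q} x∋q → decidable-stable em λ y∌q → none (q , x∋q , y∌q)

  -- Steps of length `ε` starting inside the cut must leave it by the archimedean property; `r` is
  -- the last point inside. This is what makes `-ℝ_` an additive inverse.
  located : (x : ℝ ℓ) → ∀ {ε} → 0ℚ < ε → ∃[ r ] (x ∋ r × ¬ (x ∋ (r + ε)))
  located x {ε} 0<ε = climb n (proj₂ X.inhabited) λ x∋ → ℚₚ.<-irrefl ≡.refl
      (ℚₚ.<-≤-trans (X.below-bound x∋ (proj₂ X.bounded))
        (transfer-≤ (u - l) (natℚ n * ε)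
          (solve 3 (λ u l m → u :+ m := (l :+ m) :+ (u :- l)) ≡.refl u l (natℚ n * ε))
          (proj₂ (archimedean 0<ε (u - l)))))
    where
    module X = ℝ x
    u = proj₁ X.bounded
    l = proj₁ X.inhabited
    n = proj₁ (archimedean 0<ε (u - l))
    climb : ∀ n {l} → x ∋ l → ¬ (x ∋ (l + natℚ n * ε)) → ∃[ r ] (x ∋ r × ¬ (x ∋ (r + ε)))
    climb zero {l} x∋l x∌ = ⊥-elim (x∌ (≡.subst (x ∋_)
      (solve 2 (λ l ε → l := l :+ con 0ℚ :* ε) ≡.refl l ε) x∋l))
    climb (suc n) {l} x∋l x∌ with em {P = x ∋ (l + ε)}
    ... | no  x∌l+ε = l , x∋l , x∌l+ε
    ... | yes x∋l+ε = climb n x∋l+ε λ h → x∌ (≡.subst (x ∋_)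
      (solve 3 (λ l m ε → l :+ ε :+ m :* ε := l :+ (con 1ℚ :+ m) :* ε) ≡.refl l (natℚ n) ε) h)

  +-mono : (x y u v : ℝ ℓ) → x ≤ℝ y → u ≤ℝ v → (x +ℝ u) ≤ℝ (y +ℝ v)
  +-mono x y u v x≤y u≤v (r , s , x∋r , u∋s , q≤) = r , s , x≤y x∋r , u≤v u∋s , q≤

  neg-anti : (x y : ℝ ℓ) → x ≤ℝ y → (-ℝ y) ≤ℝ (-ℝ x)
  neg-anti x y x≤y (r , q<r , y∌) = r , q<r , λ x∋ → y∌ (x≤y x∋)

  +-comm-≤ : (x y : ℝ ℓ) → (x +ℝ y) ≤ℝ (y +ℝ x)
  +-comm-≤ x y (r , s , x∋r , y∋s , q≤) =
    s , r , y∋s , x∋r , ℚₚ.≤-trans q≤ (ℚₚ.≤-reflexive (ℚₚ.+-comm r s))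

  +-assoc-≈ : (x y z : ℝ ℓ) → ((x +ℝ y) +ℝ z) ≈ℝ (x +ℝ (y +ℝ z))
  +-assoc-≈ x y z =
    (λ {q} (p , t , (r , s , x∋r , y∋s , p≤) , z∋t , q≤) →
      r , s + t , x∋r , (s , t , y∋s , z∋t , ℚₚ.≤-refl) ,
      ℚₚ.≤-trans q≤ (ℚₚ.≤-trans (ℚₚ.+-monoˡ-≤ t p≤) (ℚₚ.≤-reflexive (ℚₚ.+-assoc r s t)))) ,
    (λ {q} (r , p , x∋r , (s , t , y∋s , z∋t , p≤) , q≤) →
      r + s , t , (r , s , x∋r , y∋s , ℚₚ.≤-refl) , z∋t ,
      ℚₚ.≤-trans q≤ (ℚₚ.≤-trans (ℚₚ.+-monoʳ-≤ r p≤) (ℚₚ.≤-reflexive (≡.sym (ℚₚ.+-assoc r s t)))))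

  +-identityʳ-≈ : (x : ℝ ℓ) → (x +ℝ 0ℝ) ≈ℝ x
  +-identityʳ-≈ x =
    (λ {q} (r , s , x∋r , lift s<0 , q≤) → ℝ.downward x
      (ℚₚ.≤-<-trans q≤ (ℚₚ.<-respʳ-≡ (ℚₚ.+-identityʳ r) (ℚₚ.+-monoʳ-< r s<0))) x∋r) ,
    (λ {q} x∋q → let r , q<r , x∋r = ℝ.open∋ x x∋q in
      r , q - r , x∋r , lift (transfer-< q r (solve 2 (λ q r → q :- r :+ r := con 0ℚ :+ q) ≡.refl q r) q<r) ,
      ℚₚ.≤-reflexive (solve 2 (λ q r → q := r :+ (q :- r)) ≡.refl q r))

  +-inverseʳ-≈ : (x : ℝ ℓ) → (x -ℝ x) ≈ℝ 0ℝ
  +-inverseʳ-≈ x =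
    (λ {q} (r , s , x∋r , (t , s<t , x∌-t) , q≤) → lift (ℚₚ.≤-<-trans q≤
      (ℚₚ.<-respʳ-≡ (ℚₚ.+-inverseˡ t)
        (ℚₚ.+-mono-< (ℝ.below-bound x x∋r x∌-t) s<t)))) ,
    (λ {q} (lift q<0) →
      -- The intermediate `m` pays for the strictness in `-ℝ_`: `r` lies in the cut, `r - m` does
      -- not, and `m - r` is strictly above `q - r`.
      let m , q<m , m<0 = ℚₚ.<-dense q<0
          r , x∋r , x∌  = located x (ℚₚ.neg-antimono-< m<0)
      in r , q - r , x∋r ,
         (m - r , ℚₚ.+-monoˡ-< (- r) q<m ,
          λ h → x∌ (≡.subst (x ∋_) (solve 2 (λ m r → :- (m :- r) := r :+ (:- m)) ≡.refl m r) h)) ,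
         ℚₚ.≤-reflexive (solve 2 (λ q r → q := r :+ (q :- r)) ≡.refl q r))

  ι-+ : (p q : ℚ) → (ι {ℓ} p +ℝ ι q) ≈ℝ ι (p + q)
  ι-+ p q =
    (λ {t} (r , s , lift r<p , lift s<q , t≤) → lift (ℚₚ.≤-<-trans t≤ (ℚₚ.+-mono-< r<p s<q))) ,
    (λ {t} (lift t<p+q) →
      let r , t-q<r , r<p = ℚₚ.<-dense (transfer-< t (p + q)
            (solve 3 (λ t p q → t :- q :+ (p :+ q) := p :+ t) ≡.refl t p q) t<p+q)
      in r , t - r , lift r<p ,
         lift (transfer-< (t - q) r
           (solve 3 (λ t r q → t :- r :+ r := q :+ (t :- q)) ≡.refl t r q) t-q<r) ,
         ℚₚ.≤-reflexive (solve 2 (λ t r → t := r :+ (t :- r)) ≡.refl t r))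

  ι-neg : (p : ℚ) → (-ℝ ι {ℓ} p) ≈ℝ ι (- p)
  ι-neg p =
    (λ {q} (t , q<t , ∌) → lift (ℚₚ.<-≤-trans q<t (ℚₚ.≮⇒≥ λ -p<t → ∌ (lift
      (transfer-< (- p) t (solve 2 (λ p t → :- t :+ t := p :+ (:- p)) ≡.refl p t) -p<t))))) ,
    (λ {q} (lift q<-p) → - p , q<-p , λ (lift h) → ℚₚ.<-irrefl
      (solve 1 (λ p → :- (:- p) := p) ≡.refl p) h)

  ℝ-abelianGroup : ∀ ℓ → AbelianGroup (Level.suc ℓ) ℓ
  ℝ-abelianGroup ℓ = record
    { Carrier = ℝ ℓ ; _≈_ = _≈ℝ_ ; _∙_ = _+ℝ_ ; ε = 0ℝ ; _⁻¹ = -ℝ_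
    ; isAbelianGroup = record
      { isGroup = record
        { isMonoid = record
          { isSemigroup = record
            { isMagma = record
              { isEquivalence = record
                { refl = id , id
                ; sym = swap
                ; trans = λ (p , p′) (q , q′) → (λ h → q (p h)) , (λ h → p′ (q′ h)) }
              ; ∙-cong = λ {x} {y} {u} {v} (p , p′) (q , q′) →
                  +-mono x y u v p q , +-mono y x v u p′ q′ }
            ; assoc = +-assoc-≈ }
          ; identity = (λ x → (λ h → proj₁ (+-identityʳ-≈ x) (+-comm-≤ 0ℝ x h)) ,
                              (λ h → +-comm-≤ x 0ℝ (proj₂ (+-identityʳ-≈ x) h))) ,
                       +-identityʳ-≈ }
        ; inverse = (λ x → (λ h → proj₁ (+-inverseʳ-≈ x) (+-comm-≤ (-ℝ x) x h)) ,
                           (λ h → +-comm-≤ x (-ℝ x) (proj₂ (+-inverseʳ-≈ x) h))) ,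
                    +-inverseʳ-≈
        ; ⁻¹-cong = λ {x} {y} (p , p′) → neg-anti y x p′ , neg-anti x y p }
      ; comm = λ x y → +-comm-≤ x y , +-comm-≤ y x } }

module UnitInterval (em : ∀ {ℓ} → ExcludedMiddle ℓ) (ℓ : Level) where
  open Cuts em
  private
    G = ℝ-abelianGroup ℓ
    module G = AbelianGroup G
    module GP = AbelianGroupProperties G
    module A = AffineIdentities G

  open RawPavelkaAlgebra (standard ℓ)

  val-1# : val 1# ≈ℝ 1ℝ
  val-1# = begin
    1ℝ -ℝ 0ℝ  ≈⟨ G.∙-congˡ {1ℝ} { -ℝ 0ℝ} {0ℝ} GP.ε⁻¹≈ε ⟩
    1ℝ +ℝ 0ℝ  ≈⟨ G.identityʳ 1ℝ ⟩
    1ℝ        ∎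
    where open SetoidReasoning G.setoid

  1≤⇒≈1 : ∀ x → 1ℝ ≤ℝ val x → x ≈ 1#
  1≤⇒≈1 x 1≤x = (λ h → proj₂ val-1# ([0,1].≤1 x h)) , (λ h → 1≤x (proj₁ val-1# h))

  ⊕-mono-≤ᴵ : ∀ x y u v → x ≤ᴵ y → u ≤ᴵ v → x ⊕ u ≤ᴵ y ⊕ v
  ⊕-mono-≤ᴵ x y u v x≤y u≤v (h , q<1) = +-mono (val x) (val y) (val u) (val v) x≤y u≤v h , q<1

  ⊕-comm-≤ᴵ : ∀ x y → x ⊕ y ≤ᴵ y ⊕ x
  ⊕-comm-≤ᴵ x y (h , q<1) = +-comm-≤ (val x) (val y) h , q<1

  -- Below 1, the inner truncation is invisible because z is nonnegative.
  untruncate : ∀ x y z {q} → 1ℝ ∋ q → ((val x +ℝ val y) +ℝ val z) ∋ q → val ((x ⊕ y) ⊕ z) ∋ q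
  untruncate x y z {q} q<1 (p , t , x+y∋p , z∋t , q≤p+t) with p ℚₚ.<? 1ℚ
  ... | yes p<1 = (p , t , (x+y∋p , lift p<1) , z∋t , q≤p+t) , q<1
  ... | no  p≮1 =
    let m , q<m , m<1 = ℚₚ.<-dense (lower q<1)
    in (m , q ℚ.- m ,
        (ℝ.downward (val x +ℝ val y) (ℚₚ.<-≤-trans m<1 (ℚₚ.≮⇒≥ p≮1)) x+y∋p , lift m<1) ,
        [0,1].0≤ z (lift (transfer-< q m (solve 2 (λ q m → q :- m :+ m := con 0ℚ :+ q) ≡.refl q m) q<m)) ,
        ℚₚ.≤-reflexive (solve 2 (λ q m → q := m :+ (q :- m)) ≡.refl q m)) , q<1

  truncate : ∀ x y z {q} → val ((x ⊕ y) ⊕ z) ∋ q → ((val x +ℝ val y) +ℝ val z) ∋ q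
  truncate x y z (h , _) =
    +-mono (val (x ⊕ y)) (val x +ℝ val y) (val z) (val z) proj₁ id h

  -- A rotation keeps the brackets on the left, the shape that `truncate` and `untruncate` handle.
  -- With commutativity, one rotation gives one half of associativity and two give the other.
  ⊕-assoc-rotate : ∀ x y z → (x ⊕ y) ⊕ z ≤ᴵ (y ⊕ z) ⊕ x
  ⊕-assoc-rotate x y z h = untruncate y z x (proj₂ h)
    (+-comm-≤ (val x) (val y +ℝ val z) (proj₁ (+-assoc-≈ (val x) (val y) (val z)) (truncate x y z h)))

  ⊕-assoc-≈ : ∀ x y z → (x ⊕ y) ⊕ z ≈ x ⊕ (y ⊕ z)
  ⊕-assoc-≈ x y z =
    (λ h → ⊕-comm-≤ᴵ (y ⊕ z) x (⊕-assoc-rotate x y z h)) ,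
    (λ h → ⊕-assoc-rotate z x y (⊕-assoc-rotate y z x (⊕-comm-≤ᴵ x (y ⊕ z) h)))

  ⊕-identityʳ-≈ : ∀ x → x ⊕ 0# ≈ x
  ⊕-identityʳ-≈ x = (λ (h , _) → proj₁ (+-identityʳ-≈ (val x)) h) ,
    (λ h → proj₂ (+-identityʳ-≈ (val x)) h , [0,1].≤1 x h)

  ⊕-identityˡ-≈ : ∀ x → 0# ⊕ x ≈ x
  ⊕-identityˡ-≈ x = (λ h → proj₁ (⊕-identityʳ-≈ x) (⊕-comm-≤ᴵ 0# x h)) ,
    (λ h → ⊕-comm-≤ᴵ x 0# (proj₂ (⊕-identityʳ-≈ x) h))

  ∼-cong-≈ : ∀ x y → x ≈ y → ∼ x ≈ ∼ y
  ∼-cong-≈ x y x≈y = G.∙-congˡ {1ℝ} { -ℝ val x} { -ℝ val y} (G.⁻¹-cong {val x} {val y} x≈y)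

  ∼-involutive-≈ : ∀ x → ∼ ∼ x ≈ x
  ∼-involutive-≈ x = A.u-[u-x]≈x 1ℝ (val x)

  ⊕-zeroʳ-≈ : ∀ x → x ⊕ 1# ≈ 1#
  ⊕-zeroʳ-≈ x = 1≤⇒≈1 (x ⊕ 1#) λ {q} h →
    +-mono 0ℝ (val x) (val 1#) (val 1#) ([0,1].0≤ x) id
      (proj₂ (G.identityˡ (val 1#)) (proj₂ val-1# {q} h)) , h

  ≤ᴵ⇒≤ : ∀ x y → x ≤ᴵ y → x ≤ y
  ≤ᴵ⇒≤ x y x≤y = 1≤⇒≈1 (∼ x ⊕ y) λ h →
    +-mono (val (∼ x)) (val (∼ x)) (val x) (val y) id x≤y
      (proj₂ (GP.//-rightDividesˡ (val x) 1ℝ) h) , h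

  1⇀x≈x : ∀ x y → y ≈ 1# → ∼ y ⊕ x ≈ x
  1⇀x≈x x y y≈1 =
    (λ h → proj₁ (⊕-identityˡ-≈ x) (⊕-mono-≤ᴵ (∼ y) 0# x x (proj₁ ∼y≈0) id h)) ,
    (λ h → ⊕-mono-≤ᴵ 0# (∼ y) x x (proj₂ ∼y≈0) id (proj₂ (⊕-identityˡ-≈ x) h))
    where
    ∼y≈0 : ∼ y ≈ 0#
    ∼y≈0 = (λ h → proj₁ (∼-involutive-≈ 0#) (proj₁ (∼-cong-≈ y 1# y≈1) h)) ,
           (λ h → proj₂ (∼-cong-≈ y 1# y≈1) (proj₂ (∼-involutive-≈ 0#) h))

  -- As `x ≤ y`, the sum `(1 - y) + x` does not exceed 1, so no truncation takes place and a group
  -- identity remains.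
  [y⇀x]⇀x≈y : ∀ x y → x ≤ᴵ y → ∼ (∼ y ⊕ x) ⊕ x ≈ y
  [y⇀x]⇀x≈y x y x≤y =
    (λ (h , _) → proj₁ affine (+-mono w u (val x) (val x) (proj₁ w≈) id h)) ,
    (λ h → +-mono u w (val x) (val x) (proj₂ w≈) id (proj₂ affine h) , [0,1].≤1 y h)
    where
    w = val (∼ (∼ y ⊕ x))
    u = 1ℝ -ℝ (val (∼ y) +ℝ val x)
    affine = A.u-[[u-y]+x]+x≈y 1ℝ (val y) (val x)
    no-truncation : val (∼ y ⊕ x) ≈ℝ (val (∼ y) +ℝ val x)
    no-truncation = proj₁ , λ h → h , proj₁ (GP.//-rightDividesˡ (val y) 1ℝ)
      (+-mono (val (∼ y)) (val (∼ y)) (val x) (val y) id x≤y h)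
    w≈ : w ≈ℝ u
    w≈ = G.∙-congˡ {1ℝ} { -ℝ val (∼ y ⊕ x)} { -ℝ (val (∼ y) +ℝ val x)}
      (G.⁻¹-cong {val (∼ y ⊕ x)} {val (∼ y) +ℝ val x} no-truncation)

  łukasiewicz-≤ᴵ : ∀ x y → x ≤ᴵ y → ∼ (∼ x ⊕ y) ⊕ y ≈ ∼ (∼ y ⊕ x) ⊕ x
  łukasiewicz-≤ᴵ x y x≤y =
    (λ h → proj₂ ([y⇀x]⇀x≈y x y x≤y) (proj₁ collapse h)) ,
    (λ h → proj₂ collapse (proj₁ ([y⇀x]⇀x≈y x y x≤y) h))
    where collapse = 1⇀x≈x y (∼ x ⊕ y) (≤ᴵ⇒≤ x y x≤y)

  standard-isMVAlgebra : IsMVAlgebra rawMV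
  standard-isMVAlgebra = record
    { ⊕-isCommutativeMonoid = record
      { isMonoid = record
        { isSemigroup = record
          { isMagma = record
            { isEquivalence = record
              { refl = id , id
              ; sym = swap
              ; trans = λ (p , p′) (q , q′) → (λ h → q (p h)) , (λ h → p′ (q′ h)) }
            ; ∙-cong = λ {x} {y} {u} {v} (p , p′) (q , q′) →
                ⊕-mono-≤ᴵ x y u v p q , ⊕-mono-≤ᴵ y x v u p′ q′ }
          ; assoc = ⊕-assoc-≈ }
        ; identity = ⊕-identityˡ-≈ , ⊕-identityʳ-≈ }
      ; comm = λ x y → ⊕-comm-≤ᴵ x y , ⊕-comm-≤ᴵ y x }
    ; ∼-cong = λ {x} {y} → ∼-cong-≈ x y
    ; ∼-involutive = ∼-involutive-≈
    ; ⊕-zeroʳ = ⊕-zeroʳ-≈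
    ; łukasiewicz = λ x y → [ łukasiewicz-≤ᴵ x y , swap ∘ łukasiewicz-≤ᴵ y x ]′
        (≤ℝ-total (val x) (val y)) }

  ≤⇒≤ᴵ : ∀ x y → x ≤ y → x ≤ᴵ y
  ≤⇒≤ᴵ x y x≤y h with ≤ℝ-total (val x) (val y)
  ... | inj₁ x≤ᴵy = x≤ᴵy h
  -- Here `(x ⇀ y) ⇀ y` equals `x` because `y ≤ᴵ x`, and equals `y` because `x ⇀ y` is `1#`.
  ... | inj₂ y≤ᴵx = proj₁ (1⇀x≈x y (∼ x ⊕ y) x≤y) (proj₂ ([y⇀x]⇀x≈y y x y≤ᴵx) h)

  standard-isPavelkaAlgebra : IsPavelkaAlgebra (standard ℓ)
  standard-isPavelkaAlgebra = record
    { isMVAlgebra = standard-isMVAlgebra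
    ; const-⊕ = λ r s t eq →
        (λ (h , lift q<1) → lift (≡.subst (_ ℚ.<_) eq
          ([ (λ e → ≡.subst (_ ℚ.<_) (≡.sym e) (lower (proj₁ (ι-+ (valℚ r) (valℚ s)) h)))
           , (λ e → ≡.subst (_ ℚ.<_) (≡.sym e) q<1) ]′ (ℚₚ.⊓-sel (valℚ r ℚ.+ valℚ s) 1ℚ)))) ,
        (λ (lift q<t) →
          let q<⊓ = ≡.subst (_ ℚ.<_) (≡.sym eq) q<t in
          proj₂ (ι-+ (valℚ r) (valℚ s)) (lift (ℚₚ.<-≤-trans q<⊓ (ℚₚ.p⊓q≤p (valℚ r ℚ.+ valℚ s) 1ℚ))) ,
          lift (ℚₚ.<-≤-trans q<⊓ (ℚₚ.p⊓q≤q (valℚ r ℚ.+ valℚ s) 1ℚ)))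
    ; const-∼ = λ r s eq →
        (λ h → lift (≡.subst (_ ℚ.<_) eq (lower (proj₁ (ι-+ 1ℚ (ℚ.- valℚ r))
          (+-mono 1ℝ 1ℝ (-ℝ ι (valℚ r)) (ι (ℚ.- valℚ r)) id (proj₁ (ι-neg (valℚ r))) h))))) ,
        (λ (lift q<s) → +-mono 1ℝ 1ℝ (ι (ℚ.- valℚ r)) (-ℝ ι (valℚ r)) id (proj₂ (ι-neg (valℚ r)))
          (proj₂ (ι-+ 1ℚ (ℚ.- valℚ r)) (lift (≡.subst (_ ℚ.<_) (≡.sym eq) q<s)))) }

-- Pavelka algebras

infix 4 _≤ℚ_ _<ℚ_
_≤ℚ_ _<ℚ_ : [0,1]ℚ → [0,1]ℚ → Set
r ≤ℚ s = valℚ r ℚ.≤ valℚ s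
r <ℚ s = valℚ r ℚ.< valℚ s

1ℚᴵ : [0,1]ℚ
1ℚᴵ = mkℚᴵ 1ℚ (ℚₚ.nonNegative⁻¹ 1ℚ) ℚₚ.≤-refl

infixl 6 _⊕ℚ_
infixl 7 _·ℚ_
infix  8 ∼ℚ_
-- Opaque, so that unification does not normalise rational arithmetic.
opaque
  ∼ℚ_ : [0,1]ℚ → [0,1]ℚ
  ∼ℚ mkℚᴵ r 0≤r r≤1 = mkℚᴵ (1ℚ ℚ.- r)
    (transfer-≤ r 1ℚ (solve 1 (λ r → con 0ℚ :+ con 1ℚ := con 1ℚ :- r :+ r) ≡.refl r) r≤1)
    (transfer-≤ 0ℚ r (solve 1 (λ r → con 1ℚ :- r :+ r := con 1ℚ :+ con 0ℚ) ≡.refl r) 0≤r)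

  ∼ℚ-value : ∀ r → 1ℚ ℚ.- valℚ r ≡ valℚ (∼ℚ r)
  ∼ℚ-value r = ≡.refl

  _⊕ℚ_ : [0,1]ℚ → [0,1]ℚ → [0,1]ℚ
  mkℚᴵ r 0≤r _ ⊕ℚ mkℚᴵ s 0≤s _ = mkℚᴵ ((r ℚ.+ s) ℚ.⊓ 1ℚ)
    (ℚₚ.⊓-glb (ℚₚ.+-mono-≤ 0≤r 0≤s) (ℚₚ.nonNegative⁻¹ 1ℚ)) (ℚₚ.p⊓q≤q (r ℚ.+ s) 1ℚ)

  ⊕ℚ-value : ∀ r s → (valℚ r ℚ.+ valℚ s) ℚ.⊓ 1ℚ ≡ valℚ (r ⊕ℚ s)
  ⊕ℚ-value r s = ≡.refl

_·ℚ_ : [0,1]ℚ → [0,1]ℚ → [0,1]ℚ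
r ·ℚ s = ∼ℚ (∼ℚ r ⊕ℚ ∼ℚ s)

⇀ℚ-value : ∀ r s → (1ℚ ℚ.- valℚ r ℚ.+ valℚ s) ℚ.⊓ 1ℚ ≡ valℚ (∼ℚ r ⊕ℚ s)
⇀ℚ-value r s = ≡.trans (≡.cong (λ p → (p ℚ.+ valℚ s) ℚ.⊓ 1ℚ) (∼ℚ-value r)) (⊕ℚ-value (∼ℚ r) s)

·ℚ-value′ : ∀ r s → 1ℚ ℚ.- ((1ℚ ℚ.- valℚ r) ℚ.+ (1ℚ ℚ.- valℚ s)) ℚ.⊓ 1ℚ ≡ valℚ (r ·ℚ s)
·ℚ-value′ r s = ≡.trans (≡.cong (λ p → 1ℚ ℚ.- p)
  (≡.trans (≡.cong₂ (λ p q → (p ℚ.+ q) ℚ.⊓ 1ℚ) (∼ℚ-value r) (∼ℚ-value s))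
    (⊕ℚ-value (∼ℚ r) (∼ℚ s)))) (∼ℚ-value (∼ℚ r ⊕ℚ ∼ℚ s))

·ℚ-value : ∀ r s → valℚ (r ·ℚ s) ≡ valℚ r ℚ.+ valℚ s ℚ.- 1ℚ ⊎ valℚ (r ·ℚ s) ≡ 0ℚ
·ℚ-value r s with ℚₚ.⊓-sel ((1ℚ ℚ.- valℚ r) ℚ.+ (1ℚ ℚ.- valℚ s)) 1ℚ
... | inj₁ e = inj₁ (≡.trans (≡.sym (·ℚ-value′ r s)) (≡.trans (≡.cong (λ z → 1ℚ ℚ.- z) e)
  (solve 2 (λ r s → con 1ℚ :- ((con 1ℚ :- r) :+ (con 1ℚ :- s)) := r :+ s :- con 1ℚ) ≡.refl (valℚ r) (valℚ s))))
... | inj₂ e = inj₂ (≡.trans (≡.sym (·ℚ-value′ r s)) (≡.cong (λ z → 1ℚ ℚ.- z) e))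

·ℚ-lower : ∀ r s → valℚ r ℚ.+ valℚ s ℚ.- 1ℚ ℚ.≤ valℚ (r ·ℚ s)
·ℚ-lower r s = ≡.subst (valℚ r ℚ.+ valℚ s ℚ.- 1ℚ ℚ.≤_) (·ℚ-value′ r s)
  (transfer-≤ m ((1ℚ ℚ.- valℚ r) ℚ.+ (1ℚ ℚ.- valℚ s))
    (solve 3 (λ r s m → r :+ s :- con 1ℚ :+ ((con 1ℚ :- r) :+ (con 1ℚ :- s)) := con 1ℚ :- m :+ m)
      ≡.refl (valℚ r) (valℚ s) m)
    (ℚₚ.p⊓q≤p ((1ℚ ℚ.- valℚ r) ℚ.+ (1ℚ ℚ.- valℚ s)) 1ℚ))
  where
  m : ℚ
  m = ((1ℚ ℚ.- valℚ r) ℚ.+ (1ℚ ℚ.- valℚ s)) ℚ.⊓ 1ℚ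

·ℚ-<ˡ : ∀ r s → 0ℚᴵ <ℚ r → s <ℚ 1ℚᴵ → r ·ℚ s <ℚ r
·ℚ-<ˡ r s 0<r s<1 with ·ℚ-value r s
... | inj₁ e = ≡.subst (ℚ._< valℚ r) (≡.sym e) (transfer-< (valℚ s) 1ℚ
  (solve 2 (λ r s → r :+ s :- con 1ℚ :+ con 1ℚ := r :+ s) ≡.refl (valℚ r) (valℚ s)) s<1)
... | inj₂ e = ≡.subst (ℚ._< valℚ r) (≡.sym e) 0<r

-- The midpoint `d = (1 + c) / 2` satisfies `2 d - 1 = c`. Halving the distance to 1 leaves room for
-- multiplying two approximate truths.
below-square : ∀ c → c <ℚ 1ℚᴵ → ∃[ d ] (d <ℚ 1ℚᴵ × c ≤ℚ d ·ℚ d)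
below-square (mkℚᴵ q 0≤q q≤1) q<1 = d , p<1 , ℚₚ.≤-trans (ℚₚ.≤-reflexive
    (solve 1 (λ q → q := con ℚ.½ :* (con 1ℚ :+ q) :+ con ℚ.½ :* (con 1ℚ :+ q) :- con 1ℚ) ≡.refl q))
    (·ℚ-lower d d)
  where
  p = ℚ.½ ℚ.* (1ℚ ℚ.+ q)
  p<1 : p ℚ.< 1ℚ
  p<1 = transfer-< (ℚ.½ ℚ.* q) (ℚ.½ ℚ.* 1ℚ)
    (solve 1 (λ q → con ℚ.½ :* (con 1ℚ :+ q) :+ con ℚ.½ :* con 1ℚ := con 1ℚ :+ con ℚ.½ :* q) ≡.refl q)
    (ℚₚ.*-monoʳ-<-pos ℚ.½ q<1)
  d = mkℚᴵ p (≡.subst (ℚ._≤ p) (ℚₚ.*-zeroʳ ℚ.½)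
        (ℚₚ.*-monoˡ-≤-nonNeg ℚ.½ (ℚₚ.+-mono-≤ (ℚₚ.nonNegative⁻¹ 1ℚ) 0≤q)))
      (ℚₚ.<⇒≤ p<1)

module PavelkaProperties {c ℓ} {P : RawPavelkaAlgebra c ℓ} (isPavelka : IsPavelkaAlgebra P) where
  open RawPavelkaAlgebra P
  open IsPavelkaAlgebra isPavelka public
  open IsMVAlgebra isMVAlgebra public
  open MVProperties isMVAlgebra public

  const-1 : const 1ℚᴵ ≈ 1#
  const-1 = sym (const-∼ 0ℚᴵ 1ℚᴵ ≡.refl)

  const-∼ℚ : ∀ r → const (∼ℚ r) ≈ ∼ const r
  const-∼ℚ r = sym (const-∼ r (∼ℚ r) (∼ℚ-value r))

  const-⊕ℚ : ∀ r s → const (r ⊕ℚ s) ≈ const r ⊕ const s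
  const-⊕ℚ r s = sym (const-⊕ r s (r ⊕ℚ s) (⊕ℚ-value r s))

  const-·ℚ : ∀ r s → const (r ·ℚ s) ≈ const r · const s
  const-·ℚ r s = trans (const-∼ℚ (∼ℚ r ⊕ℚ ∼ℚ s)) (∼-cong (trans (const-⊕ℚ (∼ℚ r) (∼ℚ s))
    (⊕-cong (const-∼ℚ r) (const-∼ℚ s))))

  const-⇀ℚ : ∀ r s → const (∼ℚ r ⊕ℚ s) ≈ const r ⇀ const s
  const-⇀ℚ r s = trans (const-⊕ℚ _ _) (⊕-congʳ (const-∼ℚ r))

  const-mono : ∀ {r s} → r ≤ℚ s → const r ≤ const s
  const-mono {r} {s} r≤s = trans (⊕-congʳ (sym (const-∼ℚ r)))
    (trans (const-⊕ (∼ℚ r) s 1ℚᴵ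
      (≡.trans (⊕ℚ-value (∼ℚ r) s) (≡.trans (≡.sym (⇀ℚ-value r s))
        (ℚₚ.p≥q⇒p⊓q≡q {1ℚ ℚ.- valℚ r ℚ.+ valℚ s} {1ℚ} (transfer-≤ (valℚ r) (valℚ s)
          (solve 2 (λ r s → con 1ℚ :+ s := con 1ℚ :- r :+ s :+ r) ≡.refl (valℚ r) (valℚ s)) r≤s)))))
      const-1)

^-isMVAlgebra : ∀ {c ℓ i} {P : RawPavelkaAlgebra c ℓ} (I : Set i) →
  IsMVAlgebra (RawPavelkaAlgebra.rawMV P) → IsMVAlgebra (RawPavelkaAlgebra.rawMV (P ^ᴾ I))
^-isMVAlgebra {P = P} I isMV = record
  { ⊕-isCommutativeMonoid = record
    { isMonoid = record
      { isSemigroup = record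
        { isMagma = record
          { isEquivalence = record
            { refl = λ _ → refl
            ; sym = λ p k → sym (p k)
            ; trans = λ p q k → trans (p k) (q k) }
          ; ∙-cong = λ p q k → ⊕-cong (p k) (q k) }
        ; assoc = λ x y z k → ⊕-assoc (x k) (y k) (z k) }
      ; identity = (λ x k → ⊕-identityˡ (x k)) , (λ x k → ⊕-identityʳ (x k)) }
    ; comm = λ x y k → ⊕-comm (x k) (y k) }
  ; ∼-cong = λ p k → IsMVAlgebra.∼-cong isMV (p k)
  ; ∼-involutive = λ x k → IsMVAlgebra.∼-involutive isMV (x k)
  ; ⊕-zeroʳ = λ x k → IsMVAlgebra.⊕-zeroʳ isMV (x k)
  ; łukasiewicz = λ x y k → IsMVAlgebra.łukasiewicz isMV (x k) (y k) }
  where open MVProperties {M = RawPavelkaAlgebra.rawMV P} isMV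

^-isPavelkaAlgebra : ∀ {c ℓ i} {P : RawPavelkaAlgebra c ℓ} (I : Set i) →
  IsPavelkaAlgebra P → IsPavelkaAlgebra (P ^ᴾ I)
^-isPavelkaAlgebra {P = P} I isP = record
  { isMVAlgebra = ^-isMVAlgebra {P = P} I isMVAlgebra
  ; const-⊕ = λ r s t eq _ → const-⊕ r s t eq
  ; const-∼ = λ r s eq _ → const-∼ r s eq }
  where open IsPavelkaAlgebra isP

-- All that the proof uses of the standard Pavelka algebra; dense and ⊕-least say that
-- its elements and sums are approximated from below by constants.
record IsCompleteChain {c ℓ} (P : RawPavelkaAlgebra c ℓ) : Set (c ⊔ Level.suc ℓ) where
  open RawPavelkaAlgebra P
  field
    isPavelkaAlgebra : IsPavelkaAlgebra P
    sup           : {I : Set ℓ} → (I → Carrier) → Carrier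
    sup-upper     : ∀ {I : Set ℓ} (x : I → Carrier) i → x i ≤ sup x
    sup-least     : ∀ {I : Set ℓ} (x : I → Carrier) {y} → (∀ i → x i ≤ y) → sup x ≤ y
    total         : ∀ x y → x ≤ y ⊎ y ≤ x
    const-reflect : ∀ {r s} → const r ≤ const s → r ≤ℚ s
    dense         : ∀ {x y} → (∀ r → const r ≤ x → const r ≤ y) → x ≤ y
    ⊕-least       : ∀ {x y z} → (∀ r s → const r ≤ x → const s ≤ y → const r ⊕ const s ≤ z) →
                    x ⊕ y ≤ z

-- Quantifiers from fuzzy equivalences

module Quantifier {c ℓ} {P : RawPavelkaAlgebra c ℓ} (isChain : IsCompleteChain P) where
  open RawPavelkaAlgebra P
  open IsCompleteChain isChain
  open PavelkaProperties isPavelkaAlgebra hiding (isMVAlgebra)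

  module FuzzyRelation {I : Set ℓ} (R : I → I → Carrier)
    (R-refl : ∀ i → R i i ≈ 1#) (R-sym : ∀ i j → R i j ≤ R j i)
    (R-trans : ∀ i j k → R i j · R j k ≤ R i k) where

    ◇ : (I → Carrier) → I → Carrier
    ◇ x i = sup λ j → R i j · x j

    ◇-upper : ∀ x i j → R i j · x j ≤ ◇ x i
    ◇-upper x i j = sup-upper (λ j → R i j · x j) j

    ◇-least : ∀ x i {y} → (∀ j → R i j · x j ≤ y) → ◇ x i ≤ y
    ◇-least x i = sup-least (λ j → R i j · x j)

    ◇-extensive : ∀ x i → x i ≤ ◇ x i
    ◇-extensive x i = ≤-trans
      (≤-reflexive (trans (sym (·-identityˡ (x i))) (·-cong (sym (R-refl i)) refl)))
      (◇-upper x i i)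

    -- Residuation lets a factor pass under the supremum, where transitivity of `R` applies.
    -- Idempotence follows at once, and with symmetry and `exchange` so does the axiom for `∼`.
    R·◇≤◇ : ∀ x i j → R i j · ◇ x j ≤ ◇ x i
    R·◇≤◇ x i j = ≤-trans (≤-reflexive (·-comm _ _)) (unresidual (◇-least x j λ k →
      residual (≤-trans (≤-reflexive (trans (·-comm _ _) (sym (·-assoc _ _ _))))
        (≤-trans (·-mono (R-trans i j k) ≤-refl) (◇-upper x i k)))))

    ◇-isMonadicPavelkaAlgebra : IsMonadicPavelkaAlgebra (P ^ᴾ I) ◇
    ◇-isMonadicPavelkaAlgebra = record
      { isPavelkaAlgebra = ^-isPavelkaAlgebra I isPavelkaAlgebra
      ; E-mono = λ {x} {y} x≤y i → ◇-least x i λ j →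
          ≤-trans (·-mono ≤-refl (x≤y j)) (◇-upper y i j)
      ; E-extensive = ◇-extensive
      ; E-idempotent = λ x i → ≤-antisym (◇-least (◇ x) i (R·◇≤◇ x i)) (◇-extensive (◇ x) i)
      ; E-∼ = λ x i → ≤-antisym
          (◇-least (λ j → ∼ ◇ x j) i λ j →
            exchange (≤-trans (·-mono (R-sym i j) ≤-refl) (R·◇≤◇ x j i)))
          (◇-extensive (λ j → ∼ ◇ x j) i)
      ; E-const = λ r x i → ≤-antisym
          (≤-trans (≤-reflexive (·-comm _ _)) (unresidual (◇-least x i λ j → residual
            (≤-trans (≤-reflexive (trans (·-assoc _ _ _) (·-cong refl (·-comm _ _))))
              (◇-upper (λ j → const r · x j) i j)))))
          (◇-least (λ j → const r · x j) i λ j →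
            ≤-trans (≤-reflexive (trans (sym (·-assoc _ _ _))
              (trans (·-cong (·-comm _ _) refl) (·-assoc _ _ _))))
              (·-mono ≤-refl (◇-upper x i j))) }

module StandardChain (em : ∀ {ℓ} → ExcludedMiddle ℓ) (ℓ : Level) where
  open Cuts em
  open UnitInterval em ℓ
  open RawPavelkaAlgebra (standard ℓ)

  -- Openness of the cut yields a rational strictly above `q`. If it is negative it is no constant
  -- of the algebra, and 0 takes its place.
  approximation : ∀ (x : Carrier) {q} → val x ∋ q → ∃[ r ] (q ℚ.< valℚ r × ιᴵ r ≤ᴵ x)
  approximation x {q} x∋q with ℝ.open∋ (val x) x∋q
  ... | r , q<r , x∋r with r ℚₚ.<? 0ℚ
  ... | yes r<0 = 0ℚᴵ , ℚₚ.<-trans q<r r<0 , [0,1].0≤ x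
  ... | no  r≮0 = mkℚᴵ r (ℚₚ.≮⇒≥ r≮0) (ℚₚ.<⇒≤ (lower ([0,1].≤1 x x∋r))) , q<r ,
                  λ (lift t<r) → ℝ.downward (val x) t<r x∋r

  standard-isCompleteChain : IsCompleteChain (standard ℓ)
  standard-isCompleteChain = record
    { isPavelkaAlgebra = standard-isPavelkaAlgebra
    ; sup = ⋁
    ; sup-upper = λ x i → ≤ᴵ⇒≤ (x i) (⋁ x) λ h → inj₂ (i , h)
    ; sup-least = λ x {y} x≤y → ≤ᴵ⇒≤ (⋁ x) y λ where
        (inj₁ (lift q<0)) → [0,1].0≤ y (lift q<0)
        (inj₂ (i , h)) → ≤⇒≤ᴵ (x i) y (x≤y i) h
    ; total = λ x y → [ (λ (h : x ≤ᴵ y) → inj₁ (≤ᴵ⇒≤ x y h))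
                      , (λ (h : y ≤ᴵ x) → inj₂ (≤ᴵ⇒≤ y x h)) ]′ (≤ℝ-total (val x) (val y))
    ; const-reflect = λ {r} {s} r≤s → ℚₚ.≮⇒≥ λ s<r →
        ℚₚ.<-irrefl ≡.refl (lower (≤⇒≤ᴵ (ιᴵ r) (ιᴵ s) r≤s (lift s<r)))
    ; dense = λ {x} {y} H → ≤ᴵ⇒≤ x y λ x∋q →
        let r , q<r , r≤x = approximation x x∋q
        in ≤⇒≤ᴵ (ιᴵ r) y (H r (≤ᴵ⇒≤ (ιᴵ r) x r≤x)) (lift q<r)
    ; ⊕-least = λ {x} {y} {z} H → ≤ᴵ⇒≤ (x ⊕ y) z λ ((r , s , x∋r , y∋s , q≤r+s) , q<1) →
        let r′ , r<r′ , r′≤x = approximation x x∋r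
            s′ , s<s′ , s′≤y = approximation y y∋s
        in ≤⇒≤ᴵ (ιᴵ r′ ⊕ ιᴵ s′) z (H r′ s′ (≤ᴵ⇒≤ (ιᴵ r′) x r′≤x) (≤ᴵ⇒≤ (ιᴵ s′) y s′≤y))
             ((r , s , lift r<r′ , lift s<s′ , q≤r+s) , q<1) }

-- Subsets and maximal consistent sets

infix 4 _∈_
_∈_ : ∀ {a} {A : Set a} → A → (A → Bool) → Set
x ∈ S = S x ≡ true

module Classical (em : ∀ {ℓ} → ExcludedMiddle ℓ) where

  opaque
    -- Deciding membership turns a predicate of any level into a Boolean one, so that sets of
    -- elements, and the homomorphisms encoded by them, do not raise the universe.
    subset : ∀ {a p} {A : Set a} → (A → Set p) → A → Bool
    subset P x = does (em {P = P x})

    subset⁺ : ∀ {a p} {A : Set a} {P : A → Set p} {x} → P x → x ∈ subset P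
    subset⁺ {P = P} {x} px with em {P = P x}
    ... | yes _  = ≡.refl
    ... | no ¬px = ⊥-elim (¬px px)

    subset⁻ : ∀ {a p} {A : Set a} {P : A → Set p} {x} → x ∈ subset P → P x
    subset⁻ {P = P} {x} x∈ with em {P = P x}
    subset⁻ x∈ | yes px = px
    subset⁻ () | no _

  ¬∀⇒∃¬ : ∀ {a p} {A : Set a} {P : A → Set p} → ¬ (∀ x → P x) → ∃[ x ] ¬ P x
  ¬∀⇒∃¬ {P = P} ¬∀ = decidable-stable em λ ¬∃ →
    ¬∀ λ x → decidable-stable em λ ¬px → ¬∃ (x , ¬px)

  -- Zorn's lemma for properties of finite character.  Sets are enlarged one element at
  -- a time along well-founded trees that play the role of ordinals: ≼ compares ranks
  -- and is total.
  module MaximalExtension (ext : ∀ {a b} → Extensionality a b)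
    {a q} {A : Set a} (Q : List A → Set q) (Q-anti : ∀ {xs ys} → xs ⊆ ys → Q ys → Q xs)
    where

    Consistent : (A → Bool) → Set (a ⊔ q)
    Consistent S = ∀ xs → All (_∈ S) xs → Q xs

    private
      infix 4 _⊑_ _≼_ _≺_

      _⊑_ : (A → Bool) → (A → Bool) → Set a
      S ⊑ T = ∀ {x} → x ∈ S → x ∈ T

      -- Extensionality enters because `extend` chooses its new element from the set as a function;
      -- only equal sets are sure to lead to the same choice.
      ⊑-antisym : ∀ {S T} → S ⊑ T → T ⊑ S → S ≡ T
      ⊑-antisym {S} {T} S⊑T T⊑S = ext λ x → same (S x) (T x) S⊑T T⊑S
        where
        same : ∀ b c → (b ≡ true → c ≡ true) → (c ≡ true → b ≡ true) → b ≡ c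
        same true  c f g = ≡.sym (f ≡.refl)
        same false true  f g = g ≡.refl
        same false false f g = ≡.refl

      insert : (A → Bool) → A → A → Bool
      insert S a = subset λ x → x ∈ S ⊎ x ≡ a

      Extendable : (A → Bool) → Set (a ⊔ q)
      Extendable S = ∃[ a ] (¬ a ∈ S × Consistent (insert S a))

      extend : (A → Bool) → A → Bool
      extend S with em {P = Extendable S}
      ... | yes (a , _) = insert S a
      ... | no _        = S

      extend-⊒ : ∀ S → S ⊑ extend S
      extend-⊒ S with em {P = Extendable S}
      ... | yes _ = subset⁺ ∘ inj₁
      ... | no _  = id

      extend-consistent : ∀ S → Consistent S → Consistent (extend S)
      extend-consistent S sat with em {P = Extendable S}
      ... | yes (_ , _ , sat′) = sat′
      ... | no _               = sat

      extend-fixed : ∀ S → extend S ⊑ S → ¬ Extendable S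
      extend-fixed S fixed e with em {P = Extendable S}
      ... | yes (a , a∉S , _) = a∉S (fixed (subset⁺ (inj₂ ≡.refl)))
      ... | no ¬e             = ¬e e

      data Tree : Set (Level.suc a) where
        node : {B : Set a} → (B → Tree) → Tree

      _≼_ _≺_ : Tree → Tree → Set a
      node f ≼ node g = ∀ s → ∃[ t ] f s ≼ g t
      x ≺ node g = ∃[ t ] x ≼ g t

      ≼-or-≻ : ∀ x y → x ≼ y ⊎ y ≺ x
      ≼-or-≻ (node f) (node g) with em {P = ∀ s → ∃[ t ] f s ≼ g t}
      ... | yes f≼g = inj₁ f≼g
      ... | no ¬f≼g =
        let s , ¬∃ = ¬∀⇒∃¬ ¬f≼g
        in inj₂ (s , below (f s) λ t → fromInj₂ (λ h → ⊥-elim (¬∃ (t , h))) (≼-or-≻ (f s) (g t)))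
        where
        below : ∀ z → (∀ t → g t ≺ z) → node g ≼ z
        below (node h) g≺h = g≺h

    module _ (base : A → Bool) (base-consistent : Consistent base) where
      private
        stage : Tree → A → Bool
        stage (node f) = subset λ x → x ∈ base ⊎ (∃[ s ] x ∈ extend (stage (f s)))

        stage-mono        : ∀ x y → x ≼ y → stage x ⊑ stage y
        extend-stage-≺    : ∀ x y → x ≺ y → extend (stage x) ⊑ stage y
        -- `extend` itself need not be monotone, since its choice may change with the set. Totality
        -- of ranks helps: either the two stages coincide, or `stage y` already contains the
        -- extension of `stage x`.
        extend-stage-mono : ∀ x y → x ≼ y → extend (stage x) ⊑ extend (stage y)

        stage-mono (node f) (node g) f≼g h with subset⁻ h
        ... | inj₁ x∈base = subset⁺ (inj₁ x∈base)
        ... | inj₂ (s , k) = let t , f≼g = f≼g s in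
          subset⁺ (inj₂ (t , extend-stage-mono (f s) (g t) f≼g k))

        extend-stage-≺ x (node g) (t , x≼g) h =
          subset⁺ (inj₂ (t , extend-stage-mono x (g t) x≼g h))

        extend-stage-mono x y x≼y h with ≼-or-≻ y x
        ... | inj₁ y≼x = ≡.subst (λ S → _ ∈ extend S)
          (⊑-antisym (stage-mono x y x≼y) (stage-mono y x y≼x)) h
        ... | inj₂ x≺y = extend-⊒ (stage y) (extend-stage-≺ x y x≺y h)

        base⊑stage : ∀ x → base ⊑ stage x
        base⊑stage (node f) h = subset⁺ (inj₁ h)

        -- Branches are linearly ordered by rank, so a finite list from a limit stage already lies
        -- in the base or in one earlier extension. Consistency, a condition on finite lists, thus
        -- survives limits.
        gather : {B : Set a} (f : B → Tree) → ∀ xs → All (_∈ stage (node f)) xs →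
                 All (_∈ base) xs ⊎ (∃[ s ] All (_∈ extend (stage (f s))) xs)
        gather f [] [] = inj₁ []
        gather f (x ∷ xs) (x∈ ∷ xs∈) with subset⁻ x∈ | gather f xs xs∈
        ... | inj₁ b       | inj₁ bs       = inj₁ (b ∷ bs)
        ... | inj₁ b       | inj₂ (t , hs) =
          inj₂ (t , extend-⊒ (stage (f t)) (base⊑stage (f t) b) ∷ hs)
        ... | inj₂ (s , h) | inj₁ bs       =
          inj₂ (s , h ∷ All.map (λ b → extend-⊒ (stage (f s)) (base⊑stage (f s) b)) bs)
        ... | inj₂ (s , h) | inj₂ (t , hs) with ≼-or-≻ (f s) (f t)
        ...   | inj₁ s≼t = inj₂ (t , extend-stage-mono (f s) (f t) s≼t h ∷ hs)
        ...   | inj₂ t≺s = inj₂ (s ,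
          h ∷ All.map (λ k → extend-⊒ (stage (f s)) (extend-stage-≺ (f t) (f s) t≺s k)) hs)

        stage-consistent : ∀ x → Consistent (stage x)
        stage-consistent (node f) xs xs∈ with gather f xs xs∈
        ... | inj₁ bs       = base-consistent xs bs
        ... | inj₂ (s , hs) = extend-consistent (stage (f s)) (stage-consistent (f s)) xs hs

        union : A → Bool
        union = subset λ x → ∃[ t ] x ∈ stage t

        -- Trees form a large type, but one tree for each element of the union suffices to exhaust
        -- it, and these fit below a single node.
        last : Tree
        last = node {B = ∃[ x ] x ∈ union} λ (x , x∈) → proj₁ (subset⁻ x∈)

        union⊑last : union ⊑ stage last
        union⊑last x∈ = subset⁺ (inj₂ ((_ , x∈) , extend-⊒ (stage (proj₁ (subset⁻ x∈))) (proj₂ (subset⁻ x∈))))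

        -- An element added after `last` occurs in the stage of a node above `last`, hence in the
        -- union, which `last` exhausts.
        extend-last : extend (stage last) ⊑ stage last
        extend-last h = union⊑last (subset⁺ (node {B = ∃[ x ] x ∈ extend (stage last)} (λ _ → last) ,
          subset⁺ (inj₂ ((_ , h) , h))))

      maximal : A → Bool
      maximal = stage last

      base⊑maximal : ∀ {x} → x ∈ base → x ∈ maximal
      base⊑maximal = base⊑stage last

      maximal-consistent : Consistent maximal
      maximal-consistent = stage-consistent last

      -- If `a` cannot be inserted, some finite list violates `Q`. Gathering the occurrences of `a`
      -- at its head leaves members of the maximal set, and `Q-anti` transfers the violation.
      maximal-decides : ∀ a → a ∈ maximal ⊎ (∃[ ys ] (All (_∈ maximal) ys × ¬ Q (a ∷ ys)))
      maximal-decides a with em {P = a ∈ maximal}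
      ... | yes a∈ = inj₁ a∈
      ... | no a∉ =
        let xs , ¬Qxs′ = ¬∀⇒∃¬ {P = λ xs → All (_∈ insert maximal a) xs → Q xs}
              (λ sat → extend-fixed maximal extend-last (a , a∉ , sat))
            xs∈ , ¬Qxs = decidable-stable (em {P = All (_∈ insert maximal a) xs × ¬ Q xs})
              λ ¬both → ¬Qxs′ λ xs∈ → decidable-stable em λ ¬Qxs → ¬both (xs∈ , ¬Qxs)
            ys , ys∈ , xs⊆ = strip xs xs∈
        in inj₂ (ys , ys∈ , ¬Qxs ∘ Q-anti xs⊆)
        where
        swap-⊆ : ∀ {x xs ys} → xs ⊆ a ∷ ys → x ∷ xs ⊆ a ∷ x ∷ ys
        swap-⊆ xs⊆ (here e) = there (here e)
        swap-⊆ xs⊆ (there h) with xs⊆ h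
        ... | here e  = here e
        ... | there k = there (there k)

        strip : ∀ xs → All (_∈ insert maximal a) xs → ∃[ ys ] (All (_∈ maximal) ys × xs ⊆ a ∷ ys)
        strip [] [] = [] , [] , λ ()
        strip (x ∷ xs) (x∈ ∷ xs∈) with subset⁻ x∈ | strip xs xs∈
        ... | inj₁ x∈M    | ys , ys∈ , xs⊆ = x ∷ ys , x∈M ∷ ys∈ , swap-⊆ xs⊆
        ... | inj₂ ≡.refl | ys , ys∈ , xs⊆ = ys , ys∈ , λ where
          (here e)  → here e
          (there h) → xs⊆ h

-- Homomorphisms into [0,1]

module PointTheory (em : ∀ {ℓ} → ExcludedMiddle ℓ)
  {c ℓ} {P : RawPavelkaAlgebra c ℓ} (isPavelka : IsPavelkaAlgebra P) where
  open Classical em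
  open RawPavelkaAlgebra P
  open PavelkaProperties isPavelka

  -- The homomorphisms t : P → [0,1], each encoded by the set of all x with t x = 1.
  record IsPoint (F : Carrier → Bool) : Set (c ⊔ ℓ) where
    field
      valid        : ∀ {x} → x ≈ 1# → x ∈ F
      mp           : ∀ {x y} → x ∈ F → x ⇀ y ∈ F → y ∈ F
      const-proper : ∀ {r} → const r ∈ F → 1ℚᴵ ≤ℚ r
      linear       : ∀ x y → x ⇀ y ∈ F ⊎ y ⇀ x ∈ F
      arch         : ∀ {x} → ¬ x ∈ F → ∃[ r ] (r <ℚ 1ℚᴵ × x ⇀ const r ∈ F)

  Point : Set (c ⊔ ℓ)
  Point = Σ (Carrier → Bool) IsPoint

  infix 4 _∈ᴾ_
  _∈ᴾ_ : Carrier → Point → Set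
  x ∈ᴾ t = x ∈ proj₁ t

  Separated : Set (c ⊔ ℓ)
  Separated = ∀ {x y} → (∀ (t : Point) → x ⇀ y ∈ᴾ t) → x ≤ y

  module Filter (F : Carrier → Bool) (valid : ∀ {x} → x ≈ 1# → x ∈ F)
    (mp : ∀ {x y} → x ∈ F → x ⇀ y ∈ F → y ∈ F) where

    up : ∀ {x y} → x ≤ y → x ∈ F → y ∈ F
    up x≤y x∈ = mp x∈ (valid x≤y)

    ·-closed : ∀ {x y} → x ∈ F → y ∈ F → x · y ∈ F
    ·-closed x∈ y∈ = mp y∈ (up (residual ≤-refl) x∈)

    ⊑-trans : ∀ {x y z} → x ⇀ y ∈ F → y ⇀ z ∈ F → x ⇀ z ∈ F
    ⊑-trans p q = up (⇀-trans _ _ _) (·-closed p q)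

    ⊑-·-mono : ∀ {x y u v} → x ⇀ y ∈ F → u ⇀ v ∈ F → x · u ⇀ y · v ∈ F
    ⊑-·-mono p q = ⊑-trans (up (·-monoˡ-⇀ _ _ _) p)
        (up (≤-trans (·-monoˡ-⇀ _ _ _) (≤-reflexive (⇀-cong (·-comm _ _) (·-comm _ _)))) q)
      where
      ·-monoˡ-⇀ : ∀ x y u → x ⇀ y ≤ x · u ⇀ y · u
      ·-monoˡ-⇀ x y u = residual (≤-trans (≤-reflexive (sym (·-assoc _ _ _)))
        (·-mono (≤-trans (≤-reflexive (·-comm _ _)) (modus-ponens x y)) ≤-refl))

    ⊑-⊕-mono : ∀ {x y u v} → x ⇀ y ∈ F → u ⇀ v ∈ F → x ⊕ u ⇀ y ⊕ v ∈ F
    ⊑-⊕-mono p q = up (⇀-⊕ _ _ _ _) (·-closed p q)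

    ⊑-curry : ∀ {x y z} → x · y ⇀ z ∈ F → x ⇀ (y ⇀ z) ∈ F
    ⊑-curry = up (≤-reflexive (curry-⇀ _ _ _))

    ⊑-uncurry : ∀ {x y z} → x ⇀ (y ⇀ z) ∈ F → x · y ⇀ z ∈ F
    ⊑-uncurry = up (≤-reflexive (sym (curry-⇀ _ _ _)))

  module PointProperties {F : Carrier → Bool} (isPoint : IsPoint F) where
    open IsPoint isPoint public
    open Filter F valid mp public

    const-⊑-reflect : ∀ {r s} → const r ⇀ const s ∈ F → r ≤ℚ s
    const-⊑-reflect {r} {s} h = transfer-≤ 1ℚ (1ℚ ℚ.- valℚ r ℚ.+ valℚ s)
      (solve 2 (λ r s → r :+ (con 1ℚ :- r :+ s) := s :+ con 1ℚ) ≡.refl (valℚ r) (valℚ s))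
      (ℚₚ.≤-trans (const-proper (up (≤-reflexive (sym (const-⇀ℚ r s))) h))
        (≡.subst (ℚ._≤ 1ℚ ℚ.- valℚ r ℚ.+ valℚ s) (⇀ℚ-value r s) (ℚₚ.p⊓q≤p (1ℚ ℚ.- valℚ r ℚ.+ valℚ s) 1ℚ)))

    not-⊑ : ∀ {x y} → ¬ x ⇀ y ∈ F → y ⇀ x ∈ F
    not-⊑ x⋢y = fromInj₂ (⊥-elim ∘ x⋢y) (linear _ _)

    -- The property `arch` bounds `const r ⇀ x` by some `s < 1`. As `x` is below `r` in the linear
    -- order, divisibility gives `x = r · (r ⇀ x)`, which is at most `r · s < r`.
    strictly-below : ∀ {r x} → ¬ const r ⇀ x ∈ F → ∃[ s ] (s <ℚ r × x ⇀ const s ∈ F)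
    strictly-below {r} {x} r⋢x =
      let s , s<1 , h = arch r⋢x
      in r ·ℚ s , ·ℚ-<ˡ r s 0<r s<1 ,
         up (≤-trans (residual (≤-trans (≤-reflexive (rearrange s))
               (≤-trans (·-mono ≤-refl (modus-ponens _ _)) ≤-refl)))
             (⇀-monoʳ x (≤-reflexive (sym (const-·ℚ r s)))))
           (·-closed (not-⊑ r⋢x) h)
      where
      0<r : 0ℚᴵ <ℚ r
      0<r = ℚₚ.≰⇒> λ r≤0 → r⋢x (valid (≤-trans (const-mono r≤0) (0-min x)))
      rearrange : ∀ s → (x ⇀ const r) · ((const r ⇀ x) ⇀ const s) · x ≈
                        const r · ((const r ⇀ x) · ((const r ⇀ x) ⇀ const s))
      rearrange s = trans (·-comm _ _) (trans (sym (·-assoc _ _ _))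
        (trans (·-cong (divisibility x (const r)) refl) (·-assoc _ _ _)))

  module MaximalFilter (F : Carrier → Bool) (valid : ∀ {x} → x ≈ 1# → x ∈ F)
    (mp : ∀ {x y} → x ∈ F → x ⇀ y ∈ F → y ∈ F) (proper : ¬ 0# ∈ F)
    (maximal : ∀ {x} → ¬ x ∈ F → ∃[ k ] ∼ (x ^ k) ∈ F) where
    open Filter F valid mp

    -- If `a` is outside, some `∼ (a ^ k)` is inside, and with it `a ^ k ⇀ b`. Distributivity puts
    -- `a ^ k ∨ b`, which is `(a ^ k ⇀ b) ⇀ b`, into the filter, and modus ponens yields `b`.
    prime : ∀ {a b} → a ∨ b ∈ F → a ∈ F ⊎ b ∈ F
    prime {a} {b} a∨b∈ with em {P = a ∈ F}
    ... | yes a∈ = inj₁ a∈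
    ... | no a∉  = let k , ∼aᵏ∈ = maximal a∉ in
      inj₂ (mp (up (x≤x⊕y _ b) ∼aᵏ∈) (power k))
      where
      power : ∀ k → a ^ k ∨ b ∈ F
      power zero    = up (∨-upperˡ 1# b) (valid refl)
      power (suc k) = up (∨-·-distrib (a ^ k) a b) (·-closed (power k) a∨b∈)

    -- If `r < 1`, each further factor `const r` lowers a constant of the filter by `δ` until it
    -- reaches 0, which contradicts `proper`.
    const-proper : ∀ {r} → const r ∈ F → 1ℚᴵ ≤ℚ r
    const-proper {r} r∈ = ℚₚ.≮⇒≥ λ r<1 →
      let n , 1≤nδ = archimedean (0<δ r<1) 1ℚ
          s , s∈ , s≤ = decrease n
      in proper (up (const-mono {s} {0ℚᴵ} (exhausted (natℚ n ℚ.* δ) 1≤nδ s s≤)) s∈)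
      where
      δ : ℚ
      δ = 1ℚ ℚ.- valℚ r

      0<δ : valℚ r ℚ.< 1ℚ → 0ℚ ℚ.< δ
      0<δ = transfer-< (valℚ r) 1ℚ
        (solve 1 (λ r → con 0ℚ :+ con 1ℚ := con 1ℚ :- r :+ r) ≡.refl (valℚ r))

      exhausted : ∀ e → 1ℚ ℚ.≤ e → ∀ s → valℚ s ℚ.≤ 1ℚ ℚ.- e ⊎ valℚ s ℚ.≤ 0ℚ → valℚ s ℚ.≤ 0ℚ
      exhausted e 1≤e s (inj₂ s≤0) = s≤0
      exhausted e 1≤e s (inj₁ s≤)  = ℚₚ.≤-trans s≤ (transfer-≤ 1ℚ e
        (solve 1 (λ e → con 1ℚ :- e :+ e := con 0ℚ :+ con 1ℚ) ≡.refl e) 1≤e)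

      decrease : ∀ n →
        ∃[ s ] (const s ∈ F × (valℚ s ℚ.≤ 1ℚ ℚ.- natℚ n ℚ.* δ ⊎ valℚ s ℚ.≤ 0ℚ))
      decrease zero = 1ℚᴵ , valid const-1 ,
        inj₁ (ℚₚ.≤-reflexive (solve 1 (λ δ → con 1ℚ := con 1ℚ :- con 0ℚ :* δ) ≡.refl δ))
      decrease (suc n) with decrease n
      ... | s , s∈ , s≤ = s ·ℚ r , up (≤-reflexive (sym (const-·ℚ s r))) (·-closed s∈ r∈) , bound s≤
        where
        bound : valℚ s ℚ.≤ 1ℚ ℚ.- natℚ n ℚ.* δ ⊎ valℚ s ℚ.≤ 0ℚ →
          valℚ (s ·ℚ r) ℚ.≤ 1ℚ ℚ.- natℚ (suc n) ℚ.* δ ⊎ valℚ (s ·ℚ r) ℚ.≤ 0ℚ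
        bound s≤ with ·ℚ-value s r | s≤
        ... | inj₂ e | _        = inj₂ (ℚₚ.≤-reflexive e)
        ... | inj₁ e | inj₂ s≤0 = inj₂ (ℚₚ.≤-trans (ℚₚ.≤-reflexive e)
          (transfer-≤ (valℚ s ℚ.+ valℚ r) 1ℚ
            (solve 2 (λ s r → s :+ r :- con 1ℚ :+ con 1ℚ := con 0ℚ :+ (s :+ r)) ≡.refl (valℚ s) (valℚ r))
            (ℚₚ.+-mono-≤ s≤0 ([0,1]ℚ.≤1 r))))
        ... | inj₁ e | inj₁ s≤1-nδ = inj₁ (ℚₚ.≤-trans (ℚₚ.≤-reflexive e)
          (transfer-≤ (valℚ s) (1ℚ ℚ.- natℚ n ℚ.* (1ℚ ℚ.- valℚ r))
            (solve 3 (λ s r n → s :+ r :- con 1ℚ :+ (con 1ℚ :- n :* (con 1ℚ :- r)) :=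
               con 1ℚ :- (con 1ℚ :+ n) :* (con 1ℚ :- r) :+ s) ≡.refl (valℚ s) (valℚ r) (natℚ n))
            s≤1-nδ))

    linear : ∀ x y → x ⇀ y ∈ F ⊎ y ⇀ x ∈ F
    linear x y = prime (valid (prelinearity x y))

    ^-infinitesimal : ∀ {x} → (∀ r → r <ℚ 1ℚᴵ → const r ⇀ x ∈ F) →
                      ∀ k r → r <ℚ 1ℚᴵ → const r ⇀ x ^ k ∈ F
    ^-infinitesimal h zero    r r<1 = valid (1-max _)
    ^-infinitesimal h (suc k) r r<1 =
      let d , d<1 , r≤dd = below-square r r<1
      in ⊑-trans (valid (≤-trans (const-mono r≤dd) (≤-reflexive (const-·ℚ d d))))
           (⊑-·-mono (^-infinitesimal h k d d<1) (h d d<1))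

    -- Otherwise `x` is above every constant below 1 by linearity, and so is each power `x ^ k`. As
    -- some `∼ (x ^ k)` is in the filter, the constant `1 - ½` would be too.
    arch : ∀ {x} → ¬ x ∈ F → ∃[ r ] (r <ℚ 1ℚᴵ × x ⇀ const r ∈ F)
    arch {x} x∉ = decidable-stable em λ none →
      let k , ∼xᵏ∈ = maximal x∉
          infinitesimal = λ r r<1 →
            fromInj₁ (λ h → ⊥-elim (none (r , r<1 , h))) (linear (const r) x)
          ∼½∈ = mp ∼xᵏ∈ (up (≤-reflexive (⇀-contrapositive _ _))
            (^-infinitesimal infinitesimal k ½ℚᴵ ½<1))
      in from-no (1ℚ ℚₚ.≤? 1ℚ ℚ.- ℚ.½)
           (≡.subst (1ℚ ℚ.≤_) (≡.sym (∼ℚ-value ½ℚᴵ))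
             (const-proper {∼ℚ ½ℚᴵ} (up (≤-reflexive (sym (const-∼ℚ ½ℚᴵ))) ∼½∈)))
      where
      ½<1 = from-yes (ℚ.½ ℚₚ.<? 1ℚ)
      ½ℚᴵ = mkℚᴵ ℚ.½ (from-yes (0ℚ ℚₚ.≤? ℚ.½)) (from-yes (ℚ.½ ℚₚ.≤? 1ℚ))

    isPoint : IsPoint F
    isPoint = record
      { valid = valid ; mp = mp ; const-proper = const-proper ; linear = linear ; arch = arch }

-- Simple MV-algebras and the points of a semisimple algebra

module SimpleProperties {c ℓ} {M : RawMVAlgebra c ℓ} (isMV : IsMVAlgebra M) (isSimple : IsSimple M) where
  open RawMVAlgebra M
  open IsMVAlgebra isMV
  open MVProperties isMV
  open IsSimple isSimple

  module PrincipalFilter (a : Carrier) where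
    Above : Carrier → Set ℓ
    Above x = ∃[ k ] a ^ k ≤ x

    Above-up : ∀ {x y} → x ≤ y → Above x → Above y
    Above-up x≤y (k , aᵏ≤x) = k , ≤-trans aᵏ≤x x≤y

    Above-· : ∀ {x y} → Above x → Above y → Above (x · y)
    Above-· (k , aᵏ≤x) (m , aᵐ≤y) = m ℕ.+ k ,
      ≤-trans (≤-reflexive (^-+ a k m)) (·-mono aᵏ≤x aᵐ≤y)

    infix 4 _θ_
    _θ_ : Carrier → Carrier → Set ℓ
    x θ y = Above (x ⇀ y) × Above (y ⇀ x)

    θ-isMVCongruence : IsMVCongruence M _θ_
    θ-isMVCongruence = record
      { isEquivalence = record
        { refl = ≤⇒Above ≤-refl , ≤⇒Above ≤-refl
        ; sym = swap
        ; trans = λ (p , p′) (q , q′) →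
            Above-up (⇀-trans _ _ _) (Above-· p q) , Above-up (⇀-trans _ _ _) (Above-· q′ p′) }
      ; reflexive = λ x≈y → ≤⇒Above (≤-reflexive x≈y) , ≤⇒Above (≤-reflexive (sym x≈y))
      ; ⊕-cong = λ (p , p′) (q , q′) →
          Above-up (⇀-⊕ _ _ _ _) (Above-· p q) , Above-up (⇀-⊕ _ _ _ _) (Above-· p′ q′)
      ; ∼-cong = λ (p , p′) →
          Above-up (≤-reflexive (⇀-contrapositive _ _)) p′ ,
          Above-up (≤-reflexive (⇀-contrapositive _ _)) p }
      where
      ≤⇒Above : ∀ {x y} → x ≤ y → Above (x ⇀ y)
      ≤⇒Above x≤y = 0 , ≤-reflexive (sym x≤y)

  -- The filter of elements above a power of `a` induces a congruence identifying `a` with `1#`. By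
  -- simplicity it is full, and relating `1#` to `0#` means that a power of `a` is `0#`.
  simple⇒archimedean : ∀ {a} → ¬ a ≈ 1# → ∃[ k ] ∼ (a ^ k) ≈ 1#
  simple⇒archimedean {a} a≉1 with congruences (PrincipalFilter._θ_ a) (PrincipalFilter.θ-isMVCongruence a)
  ... | inj₁ θ⇒≈ = ⊥-elim (a≉1 (sym (θ⇒≈
    ((1 , ≤-trans (x·y≤y _ _) (y≤x⇀y _ _)) , (0 , ≤-reflexive (sym (⇀-zeroʳ a)))))))
  ... | inj₂ full = let (k , aᵏ≤1⇀0) , _ = full 1# 0# in
    k , trans (sym (⊕-identityʳ _)) (≤-trans aᵏ≤1⇀0 (≤-reflexive (⇀-identityˡ 0#)))

module FactorPoints (em : ∀ {ℓ} → ExcludedMiddle ℓ)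
  {a ℓ j s t} {P : RawPavelkaAlgebra a ℓ} (isPavelka : IsPavelkaAlgebra P)
  (semisimple : Semisimple j s t (RawPavelkaAlgebra.rawMV P)) where
  open Classical em
  open RawPavelkaAlgebra P
  open PavelkaProperties isPavelka
  open Semisimple semisimple
  open PointTheory em isPavelka

  module _ (k : J) where
    private
      module L = MVAlgebra (factor k)
      module LP = MVProperties L.isMVAlgebra
      module S = SimpleProperties L.isMVAlgebra (simple k)
      open IsMVHomomorphism (π-homo k)

    π-1 : π k 1# L.≈ L.1#
    π-1 = LP.trans (∼-homo _) (L.∼-cong 0-homo)

    π-⇀ : ∀ x y → π k (x ⇀ y) L.≈ π k x L.⇀ π k y
    π-⇀ x y = LP.trans (⊕-homo _ _) (LP.⊕-congʳ (∼-homo x))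

    π-^ : ∀ x n → π k (x ^ n) L.≈ π k x LP.^ n
    π-^ x zero    = π-1
    π-^ x (suc n) = LP.trans (∼-homo _) (L.∼-cong (LP.trans (⊕-homo _ _)
      (LP.⊕-cong (LP.trans (∼-homo _) (L.∼-cong (π-^ x n))) (∼-homo x))))

    kernel : Carrier → Bool
    kernel = subset λ x → π k x L.≈ L.1#

    kernel-isPoint : IsPoint kernel
    kernel-isPoint = MaximalFilter.isPoint kernel
      (λ x≈1 → subset⁺ (LP.trans (cong-≈ x≈1) π-1))
      (λ x∈ x⇀y∈ → subset⁺ (LP.trans
        (LP.trans (LP.sym (LP.⇀-identityˡ _)) (LP.⇀-cong (LP.sym (subset⁻ x∈)) LP.refl))
        (LP.trans (LP.sym (π-⇀ _ _)) (subset⁻ x⇀y∈))))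
      (λ 0∈ → IsSimple.nontrivial (simple k) (LP.trans (LP.sym 0-homo) (subset⁻ 0∈)))
      λ x∉ → let n , ∼xⁿ≈1 = S.simple⇒archimedean (λ πx≈1 → x∉ (subset⁺ πx≈1)) in
        n , subset⁺ (LP.trans (∼-homo _) (LP.trans (L.∼-cong (π-^ _ n)) ∼xⁿ≈1))

  points-separate : Separated
  points-separate x⊑y = separating λ k →
    MVProperties.trans (MVAlgebra.isMVAlgebra (factor k))
      (subset⁻ (x⊑y (kernel k , kernel-isPoint k)))
      (MVProperties.sym (MVAlgebra.isMVAlgebra (factor k)) (π-1 k))

-- Compactness of the space of points

module LimitPoints (em : ∀ {ℓ} → ExcludedMiddle ℓ) (ext : ∀ {a b} → Extensionality a b)
  {c ℓ} {P : RawPavelkaAlgebra c ℓ} (isPavelka : IsPavelkaAlgebra P) where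
  open Classical em
  open RawPavelkaAlgebra P
  open PavelkaProperties isPavelka
  open PointTheory em isPavelka

  ApproxSatisfiable : List Carrier → Set (c ⊔ ℓ)
  ApproxSatisfiable xs =
    ∀ r → r <ℚ 1ℚᴵ → ∃[ t ] All (λ x → const r ⇀ x ∈ᴾ t) xs

  ApproxSatisfiable-anti : ∀ {xs ys} → xs ⊆ ys → ApproxSatisfiable ys → ApproxSatisfiable xs
  ApproxSatisfiable-anti xs⊆ys sat r r<1 = let t , h = sat r r<1 in t , All-resp-⊇ xs⊆ys h

  open MaximalExtension ext ApproxSatisfiable ApproxSatisfiable-anti

  private
    upper : ∀ r s → r <ℚ 1ℚᴵ → s <ℚ 1ℚᴵ → ∃[ m ] (m <ℚ 1ℚᴵ × r ≤ℚ m × s ≤ℚ m)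
    upper r s r<1 s<1 with ℚₚ.≤-total (valℚ r) (valℚ s)
    ... | inj₁ r≤s = s , s<1 , r≤s , ℚₚ.≤-refl
    ... | inj₂ s≤r = r , r<1 , ℚₚ.≤-refl , s≤r

    lower-threshold : ∀ (t : Point) {r s x} → r ≤ℚ s → const s ⇀ x ∈ᴾ t → const r ⇀ x ∈ᴾ t
    lower-threshold t r≤s = up (⇀-antiˡ _ (const-mono r≤s))
      where open PointProperties (proj₂ t)

  module MaximalSatisfiable (F : Carrier → Bool) (F-sat : Consistent F)
    (F-decides : ∀ x → x ∈ F ⊎ (∃[ ys ] (All (_∈ F) ys × ¬ ApproxSatisfiable (x ∷ ys)))) where
    private
      Obstructed : Carrier → Set (c ⊔ ℓ)
      Obstructed a = ∃[ ys ] (All (_∈ F) ys × (∃[ r ] (r <ℚ 1ℚᴵ ×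
        (∀ t → All (λ y → const r ⇀ y ∈ᴾ t) ys → ¬ const r ⇀ a ∈ᴾ t))))

      decide : ∀ a → a ∈ F ⊎ Obstructed a
      decide a with F-decides a
      ... | inj₁ a∈ = inj₁ a∈
      ... | inj₂ (ys , ys∈ , ¬sat) = inj₂ (ys , ys∈ , decidable-stable em λ none →
        ¬sat λ r r<1 → decidable-stable em λ ¬∃ →
          none (r , r<1 , λ t hs h → ¬∃ (t , h ∷ hs)))

      -- The closure properties of `F` are proved by refuting obstructions: a genuine point that
      -- meets the finitely many elements involved, at a threshold above all those in play,
      -- contradicts the obstruction.
      member : ∀ {a} → ¬ Obstructed a → a ∈ F
      member ¬obs = fromInj₁ (⊥-elim ∘ ¬obs) (decide _)

      valid : ∀ {x} → x ≈ 1# → x ∈ F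
      valid x≈1 = member λ (ys , ys∈ , r , r<1 , obs) →
        let t , hs = F-sat ys ys∈ r r<1
            module t = PointProperties (proj₂ t)
        in obs t hs (t.valid (trans (⊕-congˡ x≈1) (⇀-zeroʳ _)))

      mp : ∀ {x y} → x ∈ F → x ⇀ y ∈ F → y ∈ F
      mp {x} {y} x∈ x⇀y∈ = member λ (ys , ys∈ , r , r<1 , obs) →
        -- Both premises hold only to degree `d`, and modus ponens multiplies the degrees, so
        -- `d · d` has to reach `r`.
        let d , d<1 , r≤dd = below-square r r<1
            m , m<1 , r≤m , d≤m = upper r d r<1 d<1
            t , hs = F-sat (x ∷ (x ⇀ y) ∷ ys) (x∈ ∷ x⇀y∈ ∷ ys∈) m m<1
        in obs t (All.map (λ {z} → lower-threshold t {x = z} r≤m) (All.tail (All.tail hs)))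
             (consequence t r≤dd (lower-threshold t {x = x} d≤m (All.head hs))
               (lower-threshold t {x = x ⇀ y} d≤m (All.head (All.tail hs))))
        where
        consequence : ∀ (t : Point) {r d} → r ≤ℚ d ·ℚ d → const d ⇀ x ∈ᴾ t →
                      const d ⇀ (x ⇀ y) ∈ᴾ t → const r ⇀ y ∈ᴾ t
        consequence t {r} {d} r≤dd h h′ = t.⊑-trans (t.⊑-trans
            (t.valid (≤-trans (const-mono r≤dd) (≤-reflexive (const-·ℚ d d))))
            (t.⊑-·-mono h h′))
            (t.valid (modus-ponens x y))
          where module t = PointProperties (proj₂ t)

      const-proper : ∀ {r} → const r ∈ F → 1ℚᴵ ≤ℚ r
      const-proper {r} r∈ = ℚₚ.≮⇒≥ λ r<1 →
        let q , r<q , q<1 = ℚₚ.<-dense r<1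
            m = mkℚᴵ q (ℚₚ.≤-trans ([0,1]ℚ.0≤ r) (ℚₚ.<⇒≤ r<q)) (ℚₚ.<⇒≤ q<1)
            t , hs = F-sat (const r ∷ []) (r∈ ∷ []) m q<1
        in ℚₚ.<-irrefl ≡.refl (ℚₚ.<-≤-trans r<q
             (PointProperties.const-⊑-reflect (proj₂ t) {m} {r} (All.head hs)))

      linear : ∀ x y → x ⇀ y ∈ F ⊎ y ⇀ x ∈ F
      linear x y with decide (x ⇀ y) | decide (y ⇀ x)
      ... | inj₁ h | _      = inj₁ h
      ... | inj₂ _ | inj₁ h = inj₂ h
      ... | inj₂ (ys , ys∈ , r , r<1 , obs) | inj₂ (zs , zs∈ , s , s<1 , obs′) =
        let m , m<1 , r≤m , s≤m = upper r s r<1 s<1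
            t , hs = F-sat (ys ++ zs) (Allₚ.++⁺ ys∈ zs∈) m m<1
            module t = PointProperties (proj₂ t)
        in [ (λ h → ⊥-elim (obs t
               (All.map (λ {z} → lower-threshold t {x = z} r≤m) (Allₚ.++⁻ˡ ys hs)) (t.up (y≤x⇀y _ _) h)))
           , (λ h → ⊥-elim (obs′ t
               (All.map (λ {z} → lower-threshold t {x = z} s≤m) (Allₚ.++⁻ʳ ys hs)) (t.up (y≤x⇀y _ _) h)))
           ]′ (t.linear x y)

      -- The threshold `r` of the obstruction is the bound sought: a point meeting `ys` to degree
      -- `r` cannot have `r` below `x`, so by linearity it has `x` below `r`.
      arch : ∀ {x} → ¬ x ∈ F → ∃[ r ] (r <ℚ 1ℚᴵ × x ⇀ const r ∈ F)
      arch {x} x∉ with decide x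
      ... | inj₁ x∈ = ⊥-elim (x∉ x∈)
      ... | inj₂ (ys , ys∈ , r , r<1 , obs) = r , r<1 , member λ (zs , zs∈ , s , s<1 , obs′) →
        let m , m<1 , r≤m , s≤m = upper r s r<1 s<1
            t , hs = F-sat (ys ++ zs) (Allₚ.++⁺ ys∈ zs∈) m m<1
            module t = PointProperties (proj₂ t)
        in obs′ t (All.map (λ {z} → lower-threshold t {x = z} s≤m) (Allₚ.++⁻ʳ ys hs))
             (t.up (y≤x⇀y _ _) (t.not-⊑ (obs t
               (All.map (λ {z} → lower-threshold t {x = z} r≤m) (Allₚ.++⁻ˡ ys hs)))))

    isPoint : IsPoint F
    isPoint = record
      { valid = valid ; mp = mp ; const-proper = const-proper ; linear = linear ; arch = arch }

  -- Compactness of the space of homomorphisms into [0,1].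
  limitPoint : ∀ base → Consistent base → ∃[ t ] (∀ {x} → x ∈ base → x ∈ᴾ t)
  limitPoint base sat =
    (maximal base sat , MaximalSatisfiable.isPoint (maximal base sat)
      (maximal-consistent base sat) (maximal-decides base sat)) ,
    base⊑maximal base sat

-- Closed elements of a monadic algebra

module MonadicPoints (em : ∀ {ℓ} → ExcludedMiddle ℓ) (ext : ∀ {a b} → Extensionality a b)
  {c ℓ} {P : RawPavelkaAlgebra c ℓ} {E : Op₁ (RawPavelkaAlgebra.Carrier P)}
  (isMonadic : IsMonadicPavelkaAlgebra P E)
  (points-separate : PointTheory.Separated em (IsMonadicPavelkaAlgebra.isPavelkaAlgebra isMonadic)) where
  open Classical em
  open RawPavelkaAlgebra P
  open IsMonadicPavelkaAlgebra isMonadic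
  open PointTheory em isPavelkaAlgebra
  open PavelkaProperties isPavelkaAlgebra
  open LimitPoints em ext isPavelkaAlgebra

  Closed : Carrier → Set ℓ
  Closed x = E x ≤ x

  E-closed : ∀ x → Closed (E x)
  E-closed x = ≤-reflexive (E-idempotent x)

  Closed-resp : ∀ {x y} → x ≈ y → Closed x → Closed y
  Closed-resp x≈y Ex≤x = ≤-trans (E-mono (≤-reflexive (sym x≈y))) (≤-trans Ex≤x (≤-reflexive x≈y))

  1-closed : Closed 1#
  1-closed = 1-max _

  ∼-closed : ∀ {x} → Closed x → Closed (∼ x)
  ∼-closed {x} Ex≤x = ≤-trans (E-mono (∼-anti Ex≤x))
    (≤-trans (≤-reflexive (E-∼ x)) (∼-anti (E-extensive x)))

  const-·-closed : ∀ {x} r → Closed x → Closed (const r · x)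
  const-·-closed {x} r Ex≤x = ≤-trans (≤-reflexive (sym (E-const r x))) (·-mono ≤-refl Ex≤x)

  const-⇀-closed : ∀ {x} r → Closed x → Closed (const r ⇀ x)
  const-⇀-closed r cl = Closed-resp
    (trans (∼-involutive _) (⊕-congˡ (∼-involutive _)))
    (∼-closed (const-·-closed r (∼-closed cl)))

  ⇀-const-closed : ∀ {x} r → Closed x → Closed (x ⇀ const r)
  ⇀-const-closed r cl = Closed-resp
    (trans (⇀-cong (const-∼ℚ r) refl) (sym (⇀-contrapositive _ _)))
    (const-⇀-closed (∼ℚ r) (∼-closed cl))

  ∧-closed : ∀ {x y} → Closed x → Closed y → Closed (x ∧ y)
  ∧-closed {x} {y} Ex≤x Ey≤y = ∧-greatest
    (≤-trans (E-mono (∧-lowerˡ x y)) Ex≤x) (≤-trans (E-mono (∧-lowerʳ x y)) Ey≤y)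

  -- If r ≤ s (E x), then some point t close to s has r ≤ t x.
  module _ (s : Point) {x : Carrier} {r : [0,1]ℚ} (0<r : 0ℚᴵ <ℚ r) (r⊑Ex : const r ⇀ E x ∈ᴾ s) where
    private
      module s = PointProperties (proj₂ s)

      Constraint : Carrier → Set (c ⊔ ℓ)
      Constraint w = ∃[ z ] (Closed z × z ∈ᴾ s × const r ⇀ z · x ≤ w)

      -- This reduces finite intersections to one constraint. The elements `z` are combined by `∧`
      -- because the axioms provide closed products only with constants, while monotonicity of `E`
      -- gives closed meets; `z · z′ ≤ z ∧ z′` keeps the result in `s`.
      single : ∀ xs → All (_∈ subset Constraint) xs →
               ∃[ z ] (Closed z × z ∈ᴾ s × All (const r ⇀ z · x ≤_) xs)
      single [] [] = 1# , 1-closed , s.valid refl , []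
      single (w ∷ ws) (w∈ ∷ ws∈) =
        let z , z-closed , z∈ , z≤   = subset⁻ w∈
            z′ , z′-closed , z′∈ , z′≤ = single ws ws∈
        in z ∧ z′ , ∧-closed z-closed z′-closed , s.up (·≤∧ z z′) (s.·-closed z∈ z′∈) ,
           ≤-trans (⇀-monoʳ _ (·-mono (∧-lowerˡ z z′) ≤-refl)) z≤ ∷
           All.map (≤-trans (⇀-monoʳ _ (·-mono (∧-lowerʳ z z′) ≤-refl))) z′≤

      -- Otherwise x lies below the closed element z ⇀ const k, and s (E x) ≤ k < r.
      no-bound : ∀ {z k} → Closed z → z ∈ᴾ s → k <ℚ r → ¬ z · x ≤ const k
      no-bound {z} {k} z-closed z∈ k<r z·x≤k =
        ℚₚ.<-irrefl ≡.refl (ℚₚ.≤-<-trans (s.const-⊑-reflect {r} {k} r⊑k) k<r)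
        where
        Ex≤z⇀k : E x ≤ z ⇀ const k
        Ex≤z⇀k = ≤-trans (E-mono (residual (≤-trans (≤-reflexive (·-comm x z)) z·x≤k)))
                         (⇀-const-closed k z-closed)
        r⊑k : const r ⇀ const k ∈ᴾ s
        r⊑k = s.mp z∈ (s.⊑-curry (s.up (⇀-antiˡ _ (≤-reflexive (·-comm z (const r))))
                (s.⊑-uncurry (s.⊑-trans r⊑Ex (s.valid Ex≤z⇀k)))))

      -- At each point the failure of `d · r ≤ z · x` reverses by linearity. Since points separate,
      -- the reversed inequality holds in the algebra itself, where `E` can be applied to it.
      bounded : ∀ {z} d → (∀ (t : Point) → ¬ const d ⇀ (const r ⇀ z · x) ∈ᴾ t) →
                z · x ≤ const (r ·ℚ d)
      bounded {z} d none = points-separate below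
        where
        below : ∀ (t : Point) → z · x ⇀ const (r ·ℚ d) ∈ᴾ t
        below t = t.not-⊑ λ h → none t (t.⊑-curry (t.up (⇀-antiˡ _ (≤-reflexive
            (trans (·-comm (const d) (const r)) (sym (const-·ℚ r d))))) h))
          where module t = PointProperties (proj₂ t)

      satisfiable : ∀ {z} → Closed z → z ∈ᴾ s → ∀ d → d <ℚ 1ℚᴵ →
                    ∃[ t ] const d ⇀ (const r ⇀ z · x) ∈ᴾ t
      satisfiable z-closed z∈ d d<1 = decidable-stable em λ none →
        no-bound z-closed z∈ (·ℚ-<ˡ r d 0<r d<1) (bounded d λ t h → none (t , h))

    attained : ∃[ t ] (∀ {z} → Closed z → z ∈ᴾ s → const r ⇀ z · x ∈ᴾ t)
    attained =
      let t , base⊆t = limitPoint (subset Constraint) λ ws ws∈ d d<1 →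
            let z , z-closed , z∈ , z≤ = single ws ws∈
                t , h = satisfiable z-closed z∈ d d<1
            in t , All.map (λ z≤w → PointProperties.up (proj₂ t) (⇀-monoʳ _ z≤w) h) z≤
      in t , λ z-closed z∈ → base⊆t (subset⁺ (_ , z-closed , z∈ , ≤-refl))

-- The representation

module Representation (em : ∀ {ℓ} → ExcludedMiddle ℓ) (ext : ∀ {a b} → Extensionality a b)
  {c ℓ d} {P : RawPavelkaAlgebra c ℓ} {E : Op₁ (RawPavelkaAlgebra.Carrier P)}
  (isMonadic : IsMonadicPavelkaAlgebra P E)
  (points-separate : PointTheory.Separated em (IsMonadicPavelkaAlgebra.isPavelkaAlgebra isMonadic))
  {S : RawPavelkaAlgebra d (c ⊔ ℓ)} (isChain : IsCompleteChain S) where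
  open RawPavelkaAlgebra P
  open IsMonadicPavelkaAlgebra isMonadic using (isPavelkaAlgebra; E-extensive)
  open PointTheory em isPavelkaAlgebra
  open PavelkaProperties isPavelkaAlgebra
  open MonadicPoints em ext isMonadic points-separate
  private
    module S where
      open RawPavelkaAlgebra S public
      open IsCompleteChain isChain public
      open PavelkaProperties (IsCompleteChain.isPavelkaAlgebra isChain) public hiding (isMVAlgebra)

  supremum : ([0,1]ℚ → Set (c ⊔ ℓ)) → S.Carrier
  supremum D = S.sup {I = ∃[ r ] D r} (S.const ∘ proj₁)

  supremum-upper : ∀ D {r} → D r → S.const r S.≤ supremum D
  supremum-upper D Dr = S.sup-upper (S.const ∘ proj₁) (_ , Dr)

  supremum-least : ∀ D {w} → (∀ {r} → D r → S.const r S.≤ w) → supremum D S.≤ w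
  supremum-least D H = S.sup-least (S.const ∘ proj₁) λ (_ , Dr) → H Dr

  e : Carrier → Point → S.Carrier
  e x t = supremum λ r → Lift (c ⊔ ℓ) (const r ⇀ x ∈ᴾ t)

  -- These are the constant lower bounds of the infimum that defines `R`; their supremum stands in
  -- for it because a complete chain is given with suprema only.
  Below : Point → Point → [0,1]ℚ → Set (c ⊔ ℓ)
  Below s t r = ∀ z → Closed z → z ∈ᴾ s → const r ⇀ z ∈ᴾ t

  R : Point → Point → S.Carrier
  R s t = supremum (Below s t)

  e-upper : ∀ {r x} t → const r ⇀ x ∈ᴾ t → S.const r S.≤ e x t
  e-upper t h = supremum-upper _ (lift h)

  e-least : ∀ {x w} t → (∀ {r} → const r ⇀ x ∈ᴾ t → S.const r S.≤ w) → e x t S.≤ w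
  e-least t H = supremum-least _ λ (lift h) → H h

  -- The supremum defining `e x t` is attained at constants: if `r` failed, `x` would lie below some
  -- `s < r` in `t`, and `s` would bound the whole family.
  e-reflect : ∀ {r x} t → S.const r S.≤ e x t → const r ⇀ x ∈ᴾ t
  e-reflect {r} {x} t r≤ex = decidable-stable em λ r⋢x →
    let s , s<r , x⊑s = t.strictly-below r⋢x
    in ℚₚ.<-irrefl ≡.refl (ℚₚ.<-≤-trans s<r (S.const-reflect {r} {s} (S.≤-trans r≤ex
         (e-least t λ r′⊑x → S.const-mono (t.const-⊑-reflect (t.⊑-trans r′⊑x x⊑s))))))
    where module t = PointProperties (proj₂ t)

  e-mono-⊑ : ∀ {x y} t → x ⇀ y ∈ᴾ t → e x t S.≤ e y t
  e-mono-⊑ t x⊑y = e-least t λ r⊑x → e-upper t (t.⊑-trans r⊑x x⊑y)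
    where module t = PointProperties (proj₂ t)

  e-cong : ∀ {x y} → x ≈ y → ∀ t → e x t S.≈ e y t
  e-cong x≈y t = S.≤-antisym (e-mono-⊑ t (t.valid (≤-reflexive x≈y)))
                             (e-mono-⊑ t (t.valid (≤-reflexive (sym x≈y))))
    where module t = PointProperties (proj₂ t)

  e-const : ∀ r t → e (const r) t S.≈ S.const r
  e-const r t = S.≤-antisym (e-least t λ s⊑r → S.const-mono (t.const-⊑-reflect s⊑r))
                            (e-upper t (t.valid ≤-refl))
    where module t = PointProperties (proj₂ t)

  e-∼ : ∀ x t → e (∼ x) t S.≈ S.∼ e x t
  e-∼ x t = S.≤-antisym
      (e-least t λ {r} r⊑∼x → S.≤∼⇒≤∼ (e-least t λ {s} s⊑x → S.≤-trans
        (S.const-mono (t.const-⊑-reflect (t.⊑-trans s⊑x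
          (t.up (≤-trans (≤-reflexive (⇀-contrapositive _ _))
                  (≤-trans (⇀-antiˡ _ (≤-reflexive (sym (∼-involutive x))))
                    (⇀-monoʳ x (≤-reflexive (sym (const-∼ℚ r)))))) r⊑∼x))))
        (S.≤-reflexive (S.const-∼ℚ r))))
      (S.dense λ r r≤∼ex → e-upper t (exact r≤∼ex))
    where
    module t = PointProperties (proj₂ t)
    exact : ∀ {r} → S.const r S.≤ S.∼ e x t → const r ⇀ ∼ x ∈ᴾ t
    exact {r} r≤∼ex = decidable-stable em λ r⋢∼x →
      let s , s<r , ∼x⊑s = t.strictly-below r⋢∼x
          ∼s⊑x = t.up (≤-trans (≤-reflexive (⇀-contrapositive _ _))
                   (≤-trans (⇀-antiˡ _ (≤-reflexive (const-∼ℚ s)))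
                     (⇀-monoʳ _ (≤-reflexive (∼-involutive x))))) ∼x⊑s
          ∼s≤∼r = S.≤-trans (S.≤-reflexive (S.sym (S.const-∼ℚ s)))
                    (S.≤-trans (e-upper t ∼s⊑x) (S.≤∼⇒≤∼ r≤∼ex))
      in ℚₚ.<-irrefl ≡.refl (ℚₚ.<-≤-trans s<r (S.const-reflect {r} {s}
           (S.≤-trans (S.≤∼⇒≤∼ ∼s≤∼r) (S.≤-reflexive (S.∼-involutive _)))))

  e-⊕ : ∀ x y t → e (x ⊕ y) t S.≈ e x t S.⊕ e y t
  e-⊕ x y t = S.≤-antisym
      -- Reading `x ⊕ y` as `∼ x ⇀ y`, each constant `s` below `∼ x` puts `s · r` below `y`.
      -- Residuation lets `s` run up to `e (∼ x) t`.
      (e-least t λ {r} r⊑x⊕y → S.≤-trans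
        (S.residual (S.≤-trans (S.≤-reflexive (S.trans (S.·-comm _ _)
            (S.·-cong (S.sym (e-∼ x t)) S.refl)))
          (S.unresidual (e-least t λ {s} s⊑∼x → S.residual
            (S.≤-trans (S.≤-reflexive (S.sym (S.const-·ℚ s r)))
              (e-upper t (t.⊑-trans (t.up (⇀-antiˡ _ (≤-reflexive (const-·ℚ s r)))
                  (t.⊑-·-mono s⊑∼x (t.up (⇀-monoʳ _ (⊕-monoˡ y (≤-reflexive (sym (∼-involutive x))))) r⊑x⊕y)))
                (t.valid (modus-ponens (∼ x) y)))))))))
        (S.⊕-monoˡ _ (S.≤-reflexive (S.∼-involutive _))))
      (S.⊕-least λ r s r≤ex s≤ey → S.≤-trans (S.≤-reflexive (S.sym (S.const-⊕ℚ r s)))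
        (e-upper t (t.up (⇀-antiˡ _ (≤-reflexive (const-⊕ℚ r s)))
          (t.⊑-⊕-mono (e-reflect t r≤ex) (e-reflect t s≤ey)))))
    where module t = PointProperties (proj₂ t)

  e-· : ∀ x y t → e (x · y) t S.≈ e x t S.· e y t
  e-· x y t = S.trans (e-∼ _ t) (S.∼-cong (S.trans (e-⊕ _ _ t)
    (S.⊕-cong (e-∼ x t) (e-∼ y t))))

  e-injective : ∀ {x y} → (∀ t → e x t S.≈ e y t) → x ≈ y
  e-injective ex≈ey = ≤-antisym (e-reflects-≤ ex≈ey) (e-reflects-≤ (S.sym ∘ ex≈ey))
    where
    e-reflects-≤ : ∀ {x y} → (∀ t → e x t S.≈ e y t) → x ≤ y
    e-reflects-≤ {x} {y} ex≈ey = points-separate λ t →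
      let module t = PointProperties (proj₂ t)
          ex⇀ey = S.trans (e-⊕ (∼ x) y t) (S.trans (S.⊕-congʳ (e-∼ x t)) (S.≤-reflexive (ex≈ey t)))
      in t.mp (t.valid const-1) (e-reflect t (S.trans (S.⊕-congˡ ex⇀ey) (S.⇀-zeroʳ _)))

  R-refl : ∀ s → R s s S.≈ S.1#
  R-refl s = S.≤-antisym (S.1-max _) (S.≤-trans (S.≤-reflexive (S.sym S.const-1))
    (supremum-upper (Below s s) λ _ _ z∈ → s.up (y≤x⇀y _ _) z∈))
    where module s = PointProperties (proj₂ s)

  -- If `w` had a value at most `d < r` at `s`, the closed element `w ⇀ const d` would be 1 there,
  -- hence at least `r` at `t`. As `w` is 1 at `t`, this gives `r ≤ d`.
  R-sym : ∀ s t → R s t S.≤ R t s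
  R-sym s t = supremum-least (Below s t) λ {r} r≤R → supremum-upper (Below t s) λ w w-closed w∈t →
    decidable-stable em λ r⋢w →
      let d , d<r , w⊑d = s.strictly-below r⋢w
      in ℚₚ.<-irrefl ≡.refl (ℚₚ.<-≤-trans d<r (t.const-⊑-reflect
           (t.⊑-trans (r≤R _ (⇀-const-closed d w-closed) w⊑d)
             (t.up (residual (modus-ponens w (const d))) w∈t))))
    where
    module s = PointProperties (proj₂ s)
    module t = PointProperties (proj₂ t)

  -- If `r` bounds the closed `z` at `t`, then `const r ⇀ z` is closed and 1 at `t`, so `q` bounds
  -- it at `u`; uncurrying gives the bound `q · r` for `z`.
  R-trans : ∀ s t u → R s t S.· R t u S.≤ R s u
  R-trans s t u = S.unresidual (supremum-least (Below s t) λ {r} r≤Rst → S.residual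
    (S.≤-trans (S.≤-reflexive (S.·-comm _ _)) (S.unresidual (supremum-least (Below t u) λ {q} q≤Rtu →
      S.residual (S.≤-trans (S.≤-reflexive (S.sym (S.const-·ℚ q r)))
        (supremum-upper (Below s u) λ z z-closed z∈ → u.up (⇀-antiˡ _ (≤-reflexive (const-·ℚ q r)))
          (u.⊑-uncurry (q≤Rtu _ (const-⇀-closed r z-closed) (r≤Rst z z-closed z∈)))))))))
    where module u = PointProperties (proj₂ u)

  R-greatest : ∀ {s t w} → (∀ {z} → Closed z → z ∈ᴾ s → w S.≤ e z t) → w S.≤ R s t
  R-greatest {s} {t} H = S.dense λ r r≤w →
    supremum-upper (Below s t) λ _ z-closed z∈ → e-reflect t (S.≤-trans r≤w (H z-closed z∈))

  open Quantifier.FuzzyRelation isChain R R-refl R-sym R-trans using (◇; ◇-upper; ◇-least)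

  ◇e≤eE : ∀ x s → ◇ (e x) s S.≤ e (E x) s
  ◇e≤eE x s = ◇-least (e x) s λ t → S.unresidual (supremum-least (Below s t) λ {r} r≤R →
      S.residual (S.≤-trans (S.≤-reflexive (S.·-comm _ _)) (S.unresidual (e-least t λ {q} q⊑x →
        S.residual (S.≤-trans (S.≤-reflexive (S.sym (S.const-·ℚ q r)))
          (e-upper s (bound t r≤R q⊑x)))))))
    where
    module s = PointProperties (proj₂ s)
    -- A value of `E x` at most `d < q · r` at `s` makes the closed element `E x ⇀ const d` equal to
    -- 1 there, hence at least `r` at `t`. There `E x` is at least `q`, so `q · r ≤ d`.
    bound : ∀ t {r q} → Below s t r → const q ⇀ x ∈ᴾ t →
            const (q ·ℚ r) ⇀ E x ∈ᴾ s
    bound t {r} {q} r≤R q⊑x = decidable-stable em λ ⋢Ex →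
      let d , d<qr , Ex⊑d = s.strictly-below ⋢Ex
      in ℚₚ.<-irrefl ≡.refl (ℚₚ.<-≤-trans d<qr (t.const-⊑-reflect
           (t.⊑-trans (t.up (⇀-antiˡ _ (≤-reflexive (const-·ℚ q r)))
               (t.⊑-·-mono (t.⊑-trans q⊑x (t.valid (E-extensive x)))
                 (r≤R _ (⇀-const-closed d (E-closed x)) Ex⊑d)))
             (t.valid (modus-ponens (E x) (const d))))))
      where module t = PointProperties (proj₂ t)

  -- As w ≰ 0, the product z · x is not truncated.
  cancel-· : ∀ {w x z} → ¬ w S.≤ S.0# → w S.≤ z S.· x → S.∼ x S.⊕ w S.≤ z
  cancel-· {w} {x} {z} w≰0 w≤z·x with S.total z (S.∼ x)
  ... | inj₁ z≤∼x = ⊥-elim (w≰0 (S.≤-trans w≤z·x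
    (S.≤-trans (S.·-mono z≤∼x S.≤-refl) (S.∼x·x≤0 x))))
  ... | inj₂ ∼x≤z = S.≤-trans (S.⊕-monoʳ _ w≤z·x)
    (S.≤-trans (S.≤-reflexive (S.⊕-comm _ _)) (S.∨-least S.≤-refl ∼x≤z))

  eE≤◇e : ∀ x s → e (E x) s S.≤ ◇ (e x) s
  eE≤◇e x s = S.dense λ r r≤eEx → case 0ℚ ℚₚ.<? valℚ r of λ where
      (no r≯0)  → S.≤-trans (S.const-mono {r} {0ℚᴵ} (ℚₚ.≮⇒≥ r≯0)) (S.0-min _)
      (yes 0<r) → let t , r⊑z·x = attained s {x} {r} 0<r (e-reflect s r≤eEx) in
        below r 0<r t r⊑z·x
    where
    below : ∀ r → 0ℚᴵ <ℚ r → ∀ t → (∀ {z} → Closed z → z ∈ᴾ s → const r ⇀ z · x ∈ᴾ t) →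
            S.const r S.≤ ◇ (e x) s
    below r 0<r t r⊑z·x = S.≤-trans r≤R·e (◇-upper (e x) s t)
      where
      module t = PointProperties (proj₂ t)
      r≤ex : S.const r S.≤ e x t
      r≤ex = e-upper t (t.⊑-trans (r⊑z·x 1-closed (IsPoint.valid (proj₂ s) refl)) (t.valid (x·y≤y _ _)))
      r≰0 : ¬ S.const r S.≤ S.0#
      r≰0 r≤0 = ℚₚ.<-irrefl ≡.refl (ℚₚ.<-≤-trans 0<r (S.const-reflect {r} {0ℚᴵ} r≤0))
      -- Since `r` is positive, `r ≤ z · x` at `t` can be solved for `z`, giving the same lower
      -- bound for every closed `z` that is 1 at `s`, and so for their infimum.
      ex⇀r≤R : e x t S.⇀ S.const r S.≤ R s t
      ex⇀r≤R = R-greatest {s} {t} λ {z} z-closed z∈ → cancel-· r≰0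
        (S.≤-trans (e-upper t (r⊑z·x z-closed z∈)) (S.≤-reflexive (e-· z x t)))
      r≤R·e : S.const r S.≤ R s t S.· e x t
      -- As `r ≤ e x t`, it is below the meet of `e x t` and `r`, which is the product
      -- `e x t · (e x t ⇀ r)`.
      r≤R·e = S.≤-trans (S.∧-greatest r≤ex S.≤-refl)
        (S.≤-trans (S.≤-reflexive (S.·-comm _ _)) (S.·-mono ex⇀r≤R S.≤-refl))

  eE≈◇e : ∀ x s → e (E x) s S.≈ ◇ (e x) s
  eE≈◇e x s = S.≤-antisym (eE≤◇e x s) (◇e≤eE x s)

  e-isPavelkaHomomorphism : IsPavelkaHomomorphism P (S ^ᴾ Point) e
  e-isPavelkaHomomorphism = record
    { cong-≈ = e-cong ; ⊕-homo = e-⊕ ; ∼-homo = e-∼ ; const-homo = e-const }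

theorem15 : (∀ {ℓ} → ExcludedMiddle ℓ) →
    (∀ {a b} → Extensionality a b) →
    ∀ {i a ℓ j s t : Level} →
    ((I : Set i) (R : I → I → [0,1] i) → IsFuzzyEquivalence R →
    IsMonadicPavelkaAlgebra ([0,1]^ I) (g R))
    ×
    ((A : MonadicPavelkaAlgebra a ℓ) → (let module A = MonadicPavelkaAlgebra A) →
    Semisimple j s t A.rawMV →
    Σ[ I ∈ Set (a ⊔ ℓ) ]
    Σ[ R ∈ (I → I → [0,1] (a ⊔ ℓ)) ]
    Σ[ e ∈ (A.Carrier → I → [0,1] (a ⊔ ℓ)) ]
    IsFuzzyEquivalence R
    × IsPavelkaHomomorphism A.pavelka ([0,1]^ I) e
    × Injective A._≈_ (RawPavelkaAlgebra._≈_ ([0,1]^ I)) e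
    × (∀ x → RawPavelkaAlgebra._≈_ ([0,1]^ I) (e (A.E x)) (g R (e x))))
theorem15 em ext {i} {a} {ℓ} = fuzzy⇒monadic , representation
  where
  fuzzy⇒monadic : (I : Set i) (R : I → I → [0,1] i) → IsFuzzyEquivalence R →
                  IsMonadicPavelkaAlgebra ([0,1]^ I) (g R)
  fuzzy⇒monadic I R isFuzzy = Quantifier.FuzzyRelation.◇-isMonadicPavelkaAlgebra standard-isCompleteChain R
      (λ i → 1≤⇒≈1 (R i i) (proj₂ (reflexive i)))
      (λ i j → ≤ᴵ⇒≤ (R i j) (R j i) (proj₁ (symmetric i j)))
      (λ i j k → ≤ᴵ⇒≤ (R i j ·ᴵ R j k) (R i k) (transitive i j k))
    where
    open IsFuzzyEquivalence isFuzzy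
    open UnitInterval em i
    open StandardChain em i

  representation : (A : MonadicPavelkaAlgebra a ℓ) → (let module A = MonadicPavelkaAlgebra A) →
    Semisimple _ _ _ A.rawMV → _
  representation A semisimple = Point , R , e ,
      record
        { reflexive = λ s → (λ h → [0,1].≤1 (R s s) h) ,
                            (λ h → proj₂ (R-refl s) (proj₂ val-1# h))
        ; symmetric = λ s t → ≤⇒≤ᴵ (R s t) (R t s) (R-sym s t) , ≤⇒≤ᴵ (R t s) (R s t) (R-sym t s)
        ; transitive = λ s t u → ≤⇒≤ᴵ (R s t ·ᴵ R t u) (R s u) (R-trans s t u) } ,
      e-isPavelkaHomomorphism , (λ {x} {y} → e-injective {x} {y}) , eE≈◇e
    where
    module A = MonadicPavelkaAlgebra A
    open PointTheory em A.isPavelkaAlgebra using (Point)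
    open UnitInterval em (a ⊔ ℓ)
    open StandardChain em (a ⊔ ℓ)
    open Representation em ext A.isMonadicPavelkaAlgebra
      (FactorPoints.points-separate em A.isPavelkaAlgebra semisimple) standard-isCompleteChain
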